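{- Let $r,\ell\geq 2$ be integers. For any integers $t_1\geq\dots\geq t_\ell>r$ and any $r$-graph $F$ satisfying $m_r(F)<m_r(K^{(r)}_{t_\ell})$, there exists an $r$-graph $G$ such that \[G\not\to(K^{(r)}_{t_1},\dots,K^{(r)}_{t_\ell}) \quad\text{and}\quad G\to(K^{(r)}_{s},F),\] where $s=R(K^{(r)}_{t_1},\dots,K^{(r)}_{t_\ell})-1$.
   Context: An $r$-graph is a pair $(V,E)$ with $E\subseteq\binom{V}{r}$; all hypergraphs are finite. $K^{(r)}_t$ is the complete $r$-graph on $t$ vertices. For $r$-graphs $G,F_1,\dots,F_\ell$, $G\to(F_1,\dots,F_\ell)$ means every $\ell$-edge-coloring of $G$ contains, for some $1\le i\le\ell$, a copy of $F_i$ all of whose edges have color $i$; otherwise $G\not\to(F_1,\dots,F_\ell)$. The Ramsey number $R(F_1,\dots,F_\ell)$ is the minimum number of vertices of an $r$-graph $G$ with $G\to(F_1,\dots,F_\ell)$. For an $r$-graph $F$ with $v(F)$ vertices and $e(F)$ edges, the maximum $r$-density is $m_r(F)=0$ if $e(F)=0$, $m_r(F)=1/r$ if $e(F)=1$, and $m_r(F)=\max_{J\subseteq F,\,v(J)>r}\frac{e(J)-1}{v(J)-r}$ if $e(F)\ge 2$. -}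

module Defs where

open import Data.Bool using (Bool; true; false; T; _∧_; not)
open import Data.Nat using (ℕ; zero; suc; _≤_; _<_; _∸_; _≡ᵇ_; _<ᵇ_; NonZero)
open import Data.Integer using (ℤ; +_; _-_)
open import Data.Rational using (ℚ; _/_; _⊔_; 0ℚ; 1/_)
import Data.Nat as ℕ
open import Data.Fin using (Fin; toℕ)
import Data.Fin as Fin
open import Data.Fin.Subset using (Subset; ∣_∣)
open import Data.Vec using (Vec; []; _∷_; lookup; tabulate)
open import Data.List using (List; []; _∷_; map; _++_; length; filterᵇ; allFin; foldr; concatMap)
open import Data.Bool.ListAction using (all; any)
open import Data.Product using (Σ; ∃; ∃-syntax; _×_; _,_)
open import Relation.Binary.PropositionalEquality using (_≡_)
open import Relation.Nullary using (does; ¬_)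
open import Function.Definitions using (Injective)

subsets : (n : ℕ) → List (Subset n)
subsets zero = [] ∷ []
subsets (suc n) = map (false ∷_) (subsets n) ++ map (true ∷_) (subsets n)

sublists : {A : Set} → List A → List (List A)
sublists [] = [] ∷ []
sublists (x ∷ xs) = sublists xs ++ map (x ∷_) (sublists xs)

_⊆ᵇ_ : ∀ {n} → Subset n → Subset n → Bool
[] ⊆ᵇ [] = true
(false ∷ p) ⊆ᵇ (_ ∷ q) = p ⊆ᵇ q
(true ∷ p) ⊆ᵇ (b ∷ q) = b ∧ (p ⊆ᵇ q)

record Graph (r : ℕ) : Set where
  field
    n       : ℕ
    E       : Subset n → Bool
    uniform : ∀ S → T (E S) → ∣ S ∣ ≡ r
open Graph public

v : ∀ {r} → Graph r → ℕ
v G = n G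

edgeList : ∀ {r} (G : Graph r) → List (Subset (n G))
edgeList G = filterᵇ (E G) (subsets (n G))

e : ∀ {r} → Graph r → ℕ
e G = length (edgeList G)

K : (r t : ℕ) → Graph r
K r t = record { n = t ; E = λ S → ∣ S ∣ ≡ᵇ r ; uniform = λ S p → lemma (∣ S ∣) r p }
  where
  open import Data.Nat.Properties using (≡ᵇ⇒≡)
  lemma : ∀ a b → T (a ≡ᵇ b) → a ≡ b
  lemma = ≡ᵇ⇒≡

image : ∀ {m k} → (Fin m → Fin k) → Subset m → Subset k
image {m} φ S = tabulate λ y → any (λ x → lookup S x ∧ does (φ x Data.Fin.≟ y)) (allFin m)
  where import Data.Fin

-- an ℓ-edge-colouring of G (only its values on edges matter)
Colouring : ∀ {r} → Graph r → ℕ → Set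
Colouring G ℓ = Subset (n G) → Fin ℓ

MonoCopy : ∀ {r ℓ} (G : Graph r) (c : Colouring G ℓ) (i : Fin ℓ) (F : Graph r) → Set
MonoCopy G c i F =
  Σ (Fin (n F) → Fin (n G)) λ φ →
    Injective _≡_ _≡_ φ ×
    (∀ S → T (E F S) → T (E G (image φ S)) × c (image φ S) ≡ i)

Arrows : ∀ {r ℓ} → Graph r → (Fin ℓ → Graph r) → Set
Arrows {ℓ = ℓ} G Fs = (c : Colouring G ℓ) → ∃[ i ] MonoCopy G c i (Fs i)

IsRamseyNumber : ∀ {r ℓ} → (Fin ℓ → Graph r) → ℕ → Set
IsRamseyNumber {r} Fs N =
  (∃[ G ] (n G ≡ N × Arrows G Fs)) ×
  (∀ (G : Graph r) → Arrows G Fs → N ≤ n G)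

ratio : (r vJ eJ : ℕ) → ℚ
ratio r vJ eJ with r <ᵇ vJ
... | false = 0ℚ
... | true  = ratioNZ (vJ ∸ r)
  where
  ratioNZ : ℕ → ℚ
  ratioNZ zero = 0ℚ
  ratioNZ (suc d) = (+ eJ - + 1) / suc d

-- values (e(J)-1)/(v(J)-r) over all subgraphs J ⊆ F with v(J) > r;
-- a subgraph J is a vertex set U together with a set of edges of F inside U
densities : ∀ {r} → Graph r → List ℚ
densities {r} F =
  concatMap (λ U →
    if? (r <ᵇ ∣ U ∣) U)
    (subsets (n F))
  where
  if? : Bool → Subset (n F) → List ℚ
  if? false U = []
  if? true  U = map (λ L → ratio r (∣ U ∣) (length L))
                    (filterᵇ (all (λ S → S ⊆ᵇ U)) (sublists (edgeList F)))

-- 1/r (r ≥ 1 in all uses; the value at r = 0 is irrelevant)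
inv : ℕ → ℚ
inv zero = 0ℚ
inv (suc k) = + 1 / suc k

m : (r : ℕ) → Graph r → ℚ
m r F with e F
... | zero = 0ℚ
... | suc zero = inv r
... | suc (suc _) = foldr _⊔_ 0ℚ (densities F)

pair : ∀ {r} → Graph r → Graph r → Fin 2 → Graph r
pair A B Fin.zero = A
pair A B (Fin.suc _) = B

{-# OPTIONS --safe #-}

-- The density hypothesis is only used to see that F contains no clique on t = t_ℓ vertices. Suppose
-- there is an s-uniform hypergraph Q, any two of whose edges share fewer than r vertices, such that
--   * every clique on at least t vertices of its r-shadow G lies in an edge of Q, and
--   * every choice of one r-subset from each edge of Q contains F.
-- Colouring the r-subsets of each edge of Q as in a good colouring of the complete r-graph on s vertices
-- (one exists by minimality of the Ramsey number) gives G ↛ (K_{t_1}, …, K_{t_ℓ}); and in a red/blue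
-- colouring of G without red K_s every edge of Q contains a blue r-set, so there is a blue F.
--
-- Q comes from the Nešetřil–Rödl partite construction. Its vertices are distributed over n₀ parts, where
-- n₀ is so large that every red/blue colouring of the r-subsets of [n₀] has a red K_s or a blue copy of F.
-- The initial system is a disjoint union of copies of F with each edge enlarged by private vertices to an
-- s-set; it suffices that the r-subset chosen from an edge of Q depends, on some copy of the initial system,
-- only on the parts meeting the edge. This is achieved for one s-set of parts after the other: the edges
-- over it become the letters of a Hales–Jewett cube, and copies of the whole system are glued along the
-- lines of the cube. An r-set lying in the cube projects, in each coordinate, to an r-set of the old
-- shadow; hence intersections smaller than r and the absence of new cliques are inherited coordinatewise.

module Submission where

open import Defs hiding (v)
open import Data.Bool using (Bool; true; false; T; T?)
import Data.Bool as Bool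
open import Data.Bool.ListAction using (all)
open import Data.Bool.Properties using (T-≡; T-∧)
open import Data.Empty using (⊥-elim)
open import Data.Fin using (Fin; zero; suc; fromℕ; _↑ˡ_; _↑ʳ_; funToFin; finToFun)
import Data.Fin as Fin
open import Data.Fin.Properties using (suc-injective; inject≤-injective; ↑ˡ-injective; ↑ʳ-injective;
  finToFun-funToFin; any?; all?; ≤fromℕ; injective⇒≤; splitAt-join; remQuot-combine)
open import Data.Fin.Subset using (Subset; ∣_∣; _∈_; _∉_; _⊆_; ⊤; ⊥)
open import Data.Fin.Subset.Properties
open import Data.List using (List; []; _∷_; allFin)
import Data.List as List
open import Data.List.Relation.Unary.Any using (here; there)
import Data.List.Relation.Unary.Any as Any
open import Data.List.Relation.Unary.All using ([]; _∷_)
import Data.List.Relation.Unary.All as All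
open import Data.List.Relation.Unary.All.Properties using (all⁺; all⁻)
open import Data.List.Relation.Unary.AllPairs using ([]; _∷_)
open import Data.List.Relation.Unary.Unique.Propositional using (Unique)
import Data.List.Relation.Unary.Unique.Propositional.Properties as Uniqueₚ
open import Data.List.Membership.Propositional using (find; lose) renaming (_∈_ to _∈ˡ_)
open import Data.List.Membership.Propositional.Properties using (∈-allFin; ∈-lookup; ∈-map⁺; ∈-map⁻;
  ∈-++⁺ˡ; ∈-++⁺ʳ; ∈-++⁻; ∈-filter⁺; ∈-filter⁻; ∈-concatMap⁺; ∈-concatMap⁻)
open import Data.List.Relation.Unary.Any.Properties using (any⁺; any⁻; lookup-index)
open import Data.Nat using (ℕ; zero; suc; _≤_; _<_; _∸_; _≡ᵇ_; _+_; _*_; _^_; z≤n; s≤s)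
import Data.Nat as ℕ
import Data.Nat.Properties as ℕₚ
open import Data.Maybe using (Maybe; just; nothing; fromMaybe; maybe′)
import Data.Maybe as Maybe
open import Data.Maybe.Properties using (just-injective)
import Data.Maybe.Properties as Maybeₚ
import Data.Product as Product
open import Data.Product using (Σ; ∃; ∃-syntax; _×_; _,_; proj₁; proj₂)
import Data.Integer as ℤ
import Data.Integer.Properties as ℤₚ
open import Data.Rational using (ℚ; 0ℚ) renaming (_<_ to _<ℚ_)
import Data.Rational as ℚ
import Data.Rational.Properties as ℚₚ
import Data.Rational.Unnormalised as ℚᵘ
import Data.Rational.Unnormalised.Properties as ℚᵘₚ
open import Data.Sum using (_⊎_; inj₁; inj₂)
open import Data.Sum.Properties using (inj₁-injective)
import Data.Sum as Sum
open import Data.Vec using (Vec; []; _∷_; here; there; lookup; tabulate; _[_]≔_; _++_)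
import Data.Vec as Vec
open import Data.Vec.Properties
open import Function using (_∘_; id; case_of_)
open import Function.Bundles using (Equivalence)
open import Function.Definitions using (Injective)
open import Relation.Binary.PropositionalEquality
open import Relation.Nullary using (¬_; Dec; yes; no; does; contradiction)
open import Relation.Nullary.Decidable using (dec-true; map′; _×-dec_; _→-dec_; ¬?; decidable-stable)

-- Images of subsets and their sizes.

does⇒ : ∀ {A : Set} (A? : Dec A) → T (does A?) → A
does⇒ (yes a) _ = a

image-∈⁺ : ∀ {a b} (φ : Fin a → Fin b) {S : Subset a} {x} → x ∈ S → φ x ∈ image φ S
image-∈⁺ φ {S} {x} x∈S = lookup⇒[]= (φ x) (image φ S)
  (trans (lookup∘tabulate _ (φ x))
    (Equivalence.to T-≡ (any⁺ _ (lose (∈-allFin x)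
      (Equivalence.from T-∧ (Equivalence.from T-≡ ([]=⇒lookup x∈S)
                            , Equivalence.from T-≡ (dec-true (φ x Fin.≟ φ x) refl)))))))

image-∈⁻ : ∀ {a b} (φ : Fin a → Fin b) (S : Subset a) {y} → y ∈ image φ S →
           ∃[ x ] (x ∈ S × φ x ≡ y)
image-∈⁻ φ S {y} y∈ with find (any⁻ _ (allFin _)
  (Equivalence.from T-≡ (trans (sym (lookup∘tabulate _ y)) ([]=⇒lookup y∈))))
... | x , _ , p = let Sx , eq = Equivalence.to T-∧ p in
  x , lookup⇒[]= x S (Equivalence.to T-≡ Sx) , does⇒ (φ x Fin.≟ y) eq

image-∘ : ∀ {a b d} (ψ : Fin b → Fin d) (φ : Fin a → Fin b) S →
          image (ψ ∘ φ) S ≡ image ψ (image φ S)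
image-∘ ψ φ S = ⊆-antisym
  (λ z∈ → let x , x∈ , eq = image-∈⁻ (ψ ∘ φ) S z∈ in
    subst (_∈ image ψ (image φ S)) eq (image-∈⁺ ψ (image-∈⁺ φ x∈)))
  (λ z∈ → let y , y∈ , eq = image-∈⁻ ψ (image φ S) z∈ ; x , x∈ , eq′ = image-∈⁻ φ S y∈ in
    subst (_∈ image (ψ ∘ φ) S) (trans (cong ψ eq′) eq) (image-∈⁺ (ψ ∘ φ) x∈))

image-cong : ∀ {a b} {φ ψ : Fin a → Fin b} → (∀ x → φ x ≡ ψ x) → ∀ S → image φ S ≡ image ψ S
image-cong {φ = φ} {ψ} φ≗ψ S = ⊆-antisym
  (λ z∈ → let x , x∈ , eq = image-∈⁻ φ S z∈ in
    subst (_∈ image ψ S) (trans (sym (φ≗ψ x)) eq) (image-∈⁺ ψ x∈))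
  (λ z∈ → let x , x∈ , eq = image-∈⁻ ψ S z∈ in
    subst (_∈ image φ S) (trans (φ≗ψ x) eq) (image-∈⁺ φ x∈))

image-injective : ∀ {a b} {φ : Fin a → Fin b} → Injective _≡_ _≡_ φ → Injective _≡_ _≡_ (image φ)
image-injective {φ = φ} inj {S} {S′} eq = ⊆-antisym (half eq) (half (sym eq))
  where
  half : ∀ {S S′} → image φ S ≡ image φ S′ → ∀ {x} → x ∈ S → x ∈ S′
  half {S} {S′} eq x∈ = let y , y∈ , e = image-∈⁻ φ S′ (subst (_ ∈_) eq (image-∈⁺ φ x∈)) in
    subst (_∈ S′) (inj e) y∈

image-suc : ∀ {a b} (φ : Fin a → Fin b) S → image (suc ∘ φ) S ≡ false ∷ image φ S
image-suc φ S = ⊆-antisym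
  (λ z∈ → let x , x∈ , eq = image-∈⁻ (suc ∘ φ) S z∈ in
    subst (_∈ (false ∷ image φ S)) eq (there (image-∈⁺ φ x∈)))
  λ { (there z∈) → let x , x∈ , eq = image-∈⁻ φ S z∈ in
    subst (_∈ image (suc ∘ φ) S) (cong suc eq) (image-∈⁺ (suc ∘ φ) x∈) }

lift-injective : ∀ {a b} {φ : Fin a → Fin b} → Injective _≡_ _≡_ φ → Injective _≡_ _≡_ (Fin.lift 1 φ)
lift-injective inj {zero} {zero} _ = refl
lift-injective inj {suc x} {suc y} eq = cong suc (inj (suc-injective eq))

image-lift : ∀ {a b} (φ : Fin a → Fin b) x S → image (Fin.lift 1 φ) (x ∷ S) ≡ x ∷ image φ S
image-lift φ x S = ⊆-antisym (λ z∈ → ⇒ (image-∈⁻ (Fin.lift 1 φ) (x ∷ S) z∈)) ⇐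
  where
  ⇒ : ∀ {z} → ∃[ y ] (y ∈ (x ∷ S) × Fin.lift 1 φ y ≡ z) → z ∈ (x ∷ image φ S)
  ⇒ (zero , here , refl) = here
  ⇒ (suc y , there y∈ , refl) = there (image-∈⁺ φ y∈)
  ⇐ : ∀ {z} → z ∈ (x ∷ image φ S) → z ∈ image (Fin.lift 1 φ) (x ∷ S)
  ⇐ {zero} here = image-∈⁺ (Fin.lift 1 φ) here
  ⇐ {suc z} (there z∈) = let y , y∈ , eq = image-∈⁻ φ S z∈ in
    subst (_∈ image (Fin.lift 1 φ) (x ∷ S)) (cong suc eq) (image-∈⁺ (Fin.lift 1 φ) (there y∈))

∣insert∣ : ∀ {a} (S : Subset a) x → x ∉ S → ∣ S [ x ]≔ true ∣ ≡ suc ∣ S ∣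
∣insert∣ (true ∷ S) zero x∉ = contradiction here x∉
∣insert∣ (false ∷ S) zero x∉ = refl
∣insert∣ (true ∷ S) (suc x) x∉ = cong suc (∣insert∣ S x (x∉ ∘ there))
∣insert∣ (false ∷ S) (suc x) x∉ = ∣insert∣ S x (x∉ ∘ there)

∈-insert⁻ : ∀ {a} (S : Subset a) x {y} → y ∈ (S [ x ]≔ true) → x ≡ y ⊎ y ∈ S
∈-insert⁻ (b ∷ S) zero here = inj₁ refl
∈-insert⁻ (b ∷ S) zero (there y∈) = inj₂ (there y∈)
∈-insert⁻ (b ∷ S) (suc x) here = inj₂ here
∈-insert⁻ (b ∷ S) (suc x) (there y∈) = Sum.map (cong suc) there (∈-insert⁻ S x y∈)

∈-insert⁺ : ∀ {a} (S : Subset a) x {y} → y ∈ S → y ∈ (S [ x ]≔ true)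
∈-insert⁺ (b ∷ S) zero here = here
∈-insert⁺ (b ∷ S) zero (there y∈) = there y∈
∈-insert⁺ (b ∷ S) (suc x) here = here
∈-insert⁺ (b ∷ S) (suc x) (there y∈) = there (∈-insert⁺ S x y∈)

image-∷ : ∀ {a b} (φ : Fin (suc a) → Fin b) S →
          image φ (true ∷ S) ≡ image (φ ∘ suc) S [ φ zero ]≔ true
image-∷ φ S = ⊆-antisym (λ z∈ → ⇒ (image-∈⁻ φ (true ∷ S) z∈)) (λ z∈ → ⇐ (∈-insert⁻ (image (φ ∘ suc) S) (φ zero) z∈))
  where
  ⇒ : ∀ {z} → ∃[ y ] (y ∈ (true ∷ S) × φ y ≡ z) → z ∈ (image (φ ∘ suc) S [ φ zero ]≔ true)
  ⇒ (zero , here , refl) = []≔-updates (image (φ ∘ suc) S) (φ zero)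
  ⇒ (suc y , there y∈ , refl) = ∈-insert⁺ (image (φ ∘ suc) S) (φ zero) (image-∈⁺ (φ ∘ suc) y∈)
  ⇐ : ∀ {z} → φ zero ≡ z ⊎ z ∈ image (φ ∘ suc) S → z ∈ image φ (true ∷ S)
  ⇐ (inj₁ refl) = image-∈⁺ φ here
  ⇐ (inj₂ z∈) = let y , y∈ , eq = image-∈⁻ (φ ∘ suc) S z∈ in
    subst (_∈ image φ (true ∷ S)) eq (image-∈⁺ φ (there y∈))

image-false∷ : ∀ {a b} (φ : Fin (suc a) → Fin b) S → image φ (false ∷ S) ≡ image (φ ∘ suc) S
image-false∷ φ S = ⊆-antisym (λ z∈ → ⇒ (image-∈⁻ φ (false ∷ S) z∈))
  (λ z∈ → let y , y∈ , eq = image-∈⁻ (φ ∘ suc) S z∈ in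
    subst (_∈ image φ (false ∷ S)) eq (image-∈⁺ φ (there y∈)))
  where
  ⇒ : ∀ {z} → ∃[ y ] (y ∈ (false ∷ S) × φ y ≡ z) → z ∈ image (φ ∘ suc) S
  ⇒ (suc y , there y∈ , refl) = image-∈⁺ (φ ∘ suc) y∈

∣image∣ : ∀ {a b} {φ : Fin a → Fin b} → Injective _≡_ _≡_ φ → ∀ S → ∣ image φ S ∣ ≡ ∣ S ∣
∣image∣ {b = b} {φ} inj [] = trans
  (cong ∣_∣ (Empty-unique {p = image φ []} λ { (_ , z∈) → case image-∈⁻ φ [] z∈ of λ () })) (∣⊥∣≡0 b)
∣image∣ {φ = φ} inj (true ∷ S) = begin
  ∣ image φ (true ∷ S) ∣                     ≡⟨ cong ∣_∣ (image-∷ φ S) ⟩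
  ∣ image (φ ∘ suc) S [ φ zero ]≔ true ∣     ≡⟨ ∣insert∣ (image (φ ∘ suc) S) (φ zero) φ0∉ ⟩
  suc ∣ image (φ ∘ suc) S ∣                  ≡⟨ cong suc (∣image∣ (suc-injective ∘ inj) S) ⟩
  suc ∣ S ∣                                  ∎
  where
  open ≡-Reasoning
  φ0∉ : φ zero ∉ image (φ ∘ suc) S
  φ0∉ z∈ with image-∈⁻ (φ ∘ suc) S z∈
  ... | x , _ , eq with inj eq
  ... | ()
∣image∣ {φ = φ} inj (false ∷ S) =
  trans (cong ∣_∣ (image-false∷ φ S)) (∣image∣ (suc-injective ∘ inj) S)

⊆∧∣≡∣⇒≡ : ∀ {a} {S S′ : Subset a} → S ⊆ S′ → ∣ S ∣ ≡ ∣ S′ ∣ → S ≡ S′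
⊆∧∣≡∣⇒≡ {S = []} {[]} _ _ = refl
⊆∧∣≡∣⇒≡ {S = true ∷ S} {true ∷ S′} sub eq =
  cong (true ∷_) (⊆∧∣≡∣⇒≡ (drop-∷-⊆ sub) (ℕₚ.suc-injective eq))
⊆∧∣≡∣⇒≡ {S = true ∷ S} {false ∷ S′} sub eq = case sub here of λ ()
⊆∧∣≡∣⇒≡ {S = false ∷ S} {true ∷ S′} sub eq =
  contradiction (subst (_≤ ∣ S′ ∣) eq (p⊆q⇒∣p∣≤∣q∣ (drop-∷-⊆ sub))) (ℕₚ.<-irrefl refl)
⊆∧∣≡∣⇒≡ {S = false ∷ S} {false ∷ S′} sub eq =
  cong (false ∷_) (⊆∧∣≡∣⇒≡ (drop-∷-⊆ sub) eq)

⊤-∣image∣ : ∀ {a b} {φ : Fin a → Fin b} → Injective _≡_ _≡_ φ → ∣ image φ ⊤ ∣ ≡ a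
⊤-∣image∣ {a} inj = trans (∣image∣ inj ⊤) (∣⊤∣≡n a)

Enumerates : ∀ {r a} → (Fin r → Fin a) → Subset a → Set
Enumerates {r} ρ S = Injective _≡_ _≡_ ρ × (∀ i → ρ i ∈ S) × (∀ {x} → x ∈ S → ∃[ i ] ρ i ≡ x)

enumeration : ∀ {a} r (S : Subset a) → ∣ S ∣ ≡ r → ∃[ ρ ] Enumerates {r} ρ S
enumeration .0 [] refl = (λ ()) , (λ {}) , (λ ()) , λ ()
enumeration .(suc ∣ S ∣) (true ∷ S) refl with enumeration ∣ S ∣ S refl
... | ρ , inj , mem , sur = Fin.lift 1 ρ , lift-injective inj ,
  (λ { zero → here ; (suc i) → there (mem i) }) ,
  λ { here → zero , refl ; (there x∈) → let i , eq = sur x∈ in suc i , cong suc eq }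
enumeration r (false ∷ S) eq with enumeration r S eq
... | ρ , inj , mem , sur = suc ∘ ρ , inj ∘ suc-injective , (λ i → there (mem i)) ,
  λ { (there x∈) → let i , eq = sur x∈ in i , cong suc eq }

image-⊤ : ∀ {r a} (ρ : Fin r → Fin a) (S : Subset a) → Enumerates ρ S → image ρ ⊤ ≡ S
image-⊤ ρ S (_ , mem , sur) = ⊆-antisym
  (λ z∈ → let i , _ , eq = image-∈⁻ ρ ⊤ z∈ in subst (_∈ S) eq (mem i))
  (λ z∈ → let i , eq = sur z∈ in subst (_∈ image ρ ⊤) eq (image-∈⁺ ρ ∈⊤))

-- Ramsey's theorem

Homogeneous : ∀ {n a} → ℕ → (Subset n → Bool) → Bool → (Fin a → Fin n) → Set
Homogeneous r c b φ = Injective _≡_ _≡_ φ × (∀ S → ∣ S ∣ ≡ r → c (image φ S) ≡ b)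

Ramsey : ℕ → ℕ → ℕ → ℕ → Set
Ramsey r a b n = (c : Subset n → Bool) →
  (∃[ φ ] Homogeneous {a = a} r c false φ) ⊎ (∃[ φ ] Homogeneous {a = b} r c true φ)

-- The vertex `zero` can be added to `θ`: on the range of `ψ` the colour of a set containing `zero`
-- is already fixed, and `θ` settles the sets avoiding it.
homogeneous-lift : ∀ {r n a b} (c : Subset (suc n) → Bool) {x} (ψ : Fin b → Fin n) (θ : Fin a → Fin b) →
  Homogeneous r (c ∘ (true ∷_)) x ψ →
  Homogeneous (suc r) (λ T → c (false ∷ image ψ T)) x θ →
  Homogeneous (suc r) c x (Fin.lift 1 (ψ ∘ θ))
homogeneous-lift c ψ θ (ψ-inj , ψ-hom) (θ-inj , θ-hom) = lift-injective (θ-inj ∘ ψ-inj) , hom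
  where
  hom : ∀ S → ∣ S ∣ ≡ _ → c (image (Fin.lift 1 (ψ ∘ θ)) S) ≡ _
  hom (true ∷ S) eq = trans
    (cong c (trans (image-lift (ψ ∘ θ) true S) (cong (true ∷_) (image-∘ ψ θ S))))
    (ψ-hom (image θ S) (trans (∣image∣ θ-inj S) (ℕₚ.suc-injective eq)))
  hom (false ∷ S) eq = trans
    (cong c (trans (image-lift (ψ ∘ θ) false S) (cong (false ∷_) (image-∘ ψ θ S))))
    (θ-hom S eq)

homogeneous-suc : ∀ {r n a b} (c : Subset (suc n) → Bool) {x} (ψ : Fin b → Fin n) (θ : Fin a → Fin b) →
  Injective _≡_ _≡_ ψ →
  Homogeneous r (λ T → c (false ∷ image ψ T)) x θ →
  Homogeneous r c x (suc ∘ ψ ∘ θ)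
homogeneous-suc c ψ θ ψ-inj (θ-inj , θ-hom) = (λ eq → θ-inj (ψ-inj (suc-injective eq))) , λ S eq → trans
  (cong c (trans (image-suc (ψ ∘ θ) S) (cong (false ∷_) (image-∘ ψ θ S)))) (θ-hom S eq)

-- Erdős-Szekeres recursion: the sets containing the vertex `zero` induce a colouring of the smaller
-- sets of remaining vertices, and inside a set homogeneous for it one of the two smaller Ramsey
-- numbers `p`, `q` applies.
ramsey : ∀ r a b → ∃ (Ramsey r a b)
ramsey zero a b = a + b , goal
  where
  image-0 : ∀ {d} (φ : Fin d → Fin (a + b)) → Injective _≡_ _≡_ φ → ∀ S → ∣ S ∣ ≡ 0 → ⊥ ≡ image φ S
  image-0 φ inj S eq = ⊆∧∣≡∣⇒≡ (λ x∈ → ⊥-elim (∉⊥ x∈)) (trans (∣⊥∣≡0 (a + b)) (sym (trans (∣image∣ inj S) eq)))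
  goal : Ramsey zero a b (a + b)
  goal c with c ⊥ in eq
  ... | false = inj₁ ((_↑ˡ b) , (λ {x} {y} → ↑ˡ-injective b x y) ,
                      λ S S0 → trans (cong c (sym (image-0 _ (λ {x} {y} → ↑ˡ-injective b x y) S S0))) eq)
  ... | true  = inj₂ ((a ↑ʳ_) , (λ {x} {y} → ↑ʳ-injective a x y) ,
                      λ S S0 → trans (cong c (sym (image-0 _ (λ {x} {y} → ↑ʳ-injective a x y) S S0))) eq)
ramsey (suc r) zero b = 0 , λ c → inj₁ ((λ ()) , (λ {}) , λ { [] () })
ramsey (suc r) (suc a) zero = 0 , λ c → inj₂ ((λ ()) , (λ {}) , λ { [] () })
ramsey (suc r) (suc a) (suc b) with ramsey (suc r) a (suc b) | ramsey (suc r) (suc a) b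
... | p , ram-p | q , ram-q with ramsey r p q
... | n , ram-n = suc n , λ c → cases c (ram-n (c ∘ (true ∷_)))
  where
  cases : (c : Subset (suc n) → Bool) →
    (∃[ φ ] Homogeneous {a = p} r (c ∘ (true ∷_)) false φ) ⊎ (∃[ φ ] Homogeneous {a = q} r (c ∘ (true ∷_)) true φ) →
    (∃[ φ ] Homogeneous {a = suc a} (suc r) c false φ) ⊎ (∃[ φ ] Homogeneous {a = suc b} (suc r) c true φ)
  cases c (inj₁ (ψ , ψ-hom)) = Sum.map
    (λ (θ , θ-hom) → _ , homogeneous-lift c ψ θ ψ-hom θ-hom)
    (λ (θ , θ-hom) → _ , homogeneous-suc c ψ θ (proj₁ ψ-hom) θ-hom) (ram-p (λ T → c (false ∷ image ψ T)))
  cases c (inj₂ (ψ , ψ-hom)) = Sum.map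
    (λ (θ , θ-hom) → _ , homogeneous-suc c ψ θ (proj₁ ψ-hom) θ-hom)
    (λ (θ , θ-hom) → _ , homogeneous-lift c ψ θ ψ-hom θ-hom) (ram-q (λ T → c (false ∷ image ψ T)))

-- The Hales–Jewett theorem

Word : ℕ → ℕ → Set
Word q n = Vec (Fin q) n

-- Combinatorial lines, with nothing as the variable letter.
VarWord : ℕ → ℕ → Set
VarWord q n = Vec (Maybe (Fin q)) n

Moving : ∀ {A : Set} {n} → Vec (Maybe A) n → Set
Moving L = ∃[ i ] lookup L i ≡ nothing

_⟪_⟫ : ∀ {q n} → VarWord q n → Fin q → Word q n
L ⟪ x ⟫ = Vec.map (fromMaybe x) L

Monochromatic : ∀ {q n} {C : Set} → (Word q n → C) → VarWord q n → Set
Monochromatic χ L = Moving L × (∀ x y → χ (L ⟪ x ⟫) ≡ χ (L ⟪ y ⟫))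

HalesJewett : ℕ → ℕ → ℕ → Set
HalesJewett q c n = (χ : Word q n → Fin c) → ∃ (Monochromatic χ)

-- The lines are monochromatic up to the letter zero, where they all meet; k > c of them cannot exist.
record Focused {q n c} (k : ℕ) (χ : Word (suc q) n → Fin c) : Set where
  field
    focus        : Word (suc q) n
    line         : Fin k → VarWord (suc q) n
    colour       : Fin k → Fin c
    moving       : ∀ i → Moving (line i)
    focused      : ∀ i → line i ⟪ zero ⟫ ≡ focus
    coloured     : ∀ i x → χ (line i ⟪ suc x ⟫) ≡ colour i
    colour-injective : Injective _≡_ _≡_ colour

const-line : ∀ {q m n} → Word q m → VarWord q n → VarWord q (m + n)
const-line w L = Vec.map just w ++ L

raise : ∀ {q n} → VarWord q n → VarWord (suc q) n
raise = Vec.map (Maybe.map suc)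

module _ where
  open ≡-Reasoning

  ++-⟪⟫ : ∀ {q m n} (L : VarWord q m) (M : VarWord q n) x → (L ++ M) ⟪ x ⟫ ≡ L ⟪ x ⟫ ++ M ⟪ x ⟫
  ++-⟪⟫ L M x = map-++ (fromMaybe x) L M

  just-⟪⟫ : ∀ {q n} (w : Word q n) x → Vec.map just w ⟪ x ⟫ ≡ w
  just-⟪⟫ w x = trans (sym (map-∘ (fromMaybe x) just w)) (map-id w)

  const-⟪⟫ : ∀ {q m n} (w : Word q m) (L : VarWord q n) x → const-line w L ⟪ x ⟫ ≡ w ++ L ⟪ x ⟫
  const-⟪⟫ w L x = trans (++-⟪⟫ (Vec.map just w) L x) (cong (_++ L ⟪ x ⟫) (just-⟪⟫ w x))

  raise-⟪⟫ : ∀ {q n} (L : VarWord q n) x → raise L ⟪ suc x ⟫ ≡ Vec.map suc (L ⟪ x ⟫)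
  raise-⟪⟫ L x = begin
    Vec.map (fromMaybe (suc x)) (Vec.map (Maybe.map suc) L)  ≡⟨ map-∘ _ _ L ⟨
    Vec.map (fromMaybe (suc x) ∘ Maybe.map suc) L            ≡⟨ map-cong (λ { nothing → refl ; (just _) → refl }) L ⟩
    Vec.map (suc ∘ fromMaybe x) L                            ≡⟨ map-∘ _ _ L ⟩
    Vec.map suc (L ⟪ x ⟫)                                    ∎

moving-++ʳ : ∀ {A : Set} {m n} (L : Vec (Maybe A) m) {M : Vec (Maybe A) n} → Moving M → Moving (L ++ M)
moving-++ʳ L {M} (i , eq) = _ ↑ʳ i , trans (lookup-++ʳ L M i) eq

moving-++ˡ : ∀ {A : Set} {m n} {L : Vec (Maybe A) m} (M : Vec (Maybe A) n) → Moving L → Moving (L ++ M)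
moving-++ˡ {L = L} M (i , eq) = i ↑ˡ _ , trans (lookup-++ˡ L M i) eq

moving-raise : ∀ {q n} {L : VarWord q n} → Moving L → Moving (raise L)
moving-raise {L = L} (i , eq) = i , trans (lookup-map i (Maybe.map suc) L) (cong (Maybe.map suc) eq)

-- Packs a whole colouring of the words of length `n` into a single colour, so that Hales-Jewett can
-- be applied with such colours.
code : ∀ {q n c} → (Word q n → Fin c) → Fin (c ^ (q ^ n))
code χ = funToFin (λ i → χ (tabulate (finToFun i)))

code-injective : ∀ {q n c} (χ χ′ : Word q n → Fin c) → code χ ≡ code χ′ → ∀ w → χ w ≡ χ′ w
code-injective χ χ′ eq w = begin
  χ w                                 ≡⟨ cong χ word≡w ⟨
  χ (tabulate (finToFun i))           ≡⟨ finToFun-funToFin _ i ⟨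
  finToFun (code χ) i                 ≡⟨ cong (λ z → finToFun z i) eq ⟩
  finToFun (code χ′) i                ≡⟨ finToFun-funToFin _ i ⟩
  χ′ (tabulate (finToFun i))          ≡⟨ cong χ′ word≡w ⟩
  χ′ w                                ∎
  where
  open ≡-Reasoning
  i = funToFin (lookup w)
  word≡w : tabulate (finToFun i) ≡ w
  word≡w = trans (tabulate-cong (finToFun-funToFin (lookup w))) (tabulate∘lookup w)

module Focusing {q c : ℕ} (hj : ∀ d → ∃ (HalesJewett (suc q) d)) where

  Claim : ℕ → ℕ → Set
  Claim k n = (χ : Word (suc (suc q)) n → Fin c) → ∃ (Monochromatic χ) ⊎ Focused k χ

  -- Colour focusing: a line in `m` fresh coordinates along which the colouring of all tails is
  -- constant over the nonzero letters allows the `k` old focused lines to be prolonged diagonally,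
  -- and contributes one more.
  claim : ∀ k → ∃ (Claim k)
  claim zero = 0 , λ χ → inj₂ record
    { focus = [] ; line = λ () ; colour = λ () ; moving = λ () ; focused = λ ()
    ; coloured = λ () ; colour-injective = λ {} }
  claim (suc k) with claim k
  ... | n , claim-n with hj (c ^ (suc (suc q) ^ n))
  ... | m , hj-m = m + n , step
    where
    step : Claim (suc k) (m + n)
    -- The smaller alphabet plays the nonzero letters; a word is coloured by the colouring it
    -- induces on all tails.
    step χ with hj-m (λ w → code (λ v → χ (Vec.map suc w ++ v)))
    ... | L , L-moving , L-mono = conclude (claim-n χ₀)
      where
      w₀ : Word (suc (suc q)) m
      w₀ = raise L ⟪ suc zero ⟫
      χ₀ : Word (suc (suc q)) n → Fin c
      χ₀ v = χ (w₀ ++ v)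

      χ-raise : ∀ x v → χ (raise L ⟪ suc x ⟫ ++ v) ≡ χ₀ v
      χ-raise x v = begin
        χ (raise L ⟪ suc x ⟫ ++ v)             ≡⟨ cong (λ z → χ (z ++ v)) (raise-⟪⟫ L x) ⟩
        χ (Vec.map suc (L ⟪ x ⟫) ++ v)         ≡⟨ code-injective _ _ (L-mono x zero) v ⟩
        χ (Vec.map suc (L ⟪ zero ⟫) ++ v)      ≡⟨ cong (λ z → χ (z ++ v)) (raise-⟪⟫ L zero) ⟨
        χ₀ v                                   ∎
        where open ≡-Reasoning

      mono-const : ∀ M → Monochromatic χ₀ M → ∃ (Monochromatic χ)
      mono-const M (mv , mono) = const-line w₀ M , moving-++ʳ (Vec.map just w₀) mv , λ x y →
        trans (cong χ (const-⟪⟫ w₀ M x)) (trans (mono x y) (sym (cong χ (const-⟪⟫ w₀ M y))))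

      conclude : ∃ (Monochromatic χ₀) ⊎ Focused k χ₀ → ∃ (Monochromatic χ) ⊎ Focused (suc k) χ
      conclude (inj₁ (M , M-mono)) = inj₁ (mono-const M M-mono)
      -- If the focus has the colour of line `i`, that line is monochromatic also at `zero`;
      -- otherwise the colour of the focus is new and belongs to the line that moves in `L` alone.
      conclude (inj₂ foc) with any? (λ i → χ₀ (Focused.focus foc) Fin.≟ Focused.colour foc i)
      ... | yes (i , eq) = inj₁ (mono-const (line i)
        (moving i , λ x y → trans (colour-of x) (sym (colour-of y))))
        where
        open Focused foc
        colour-of : ∀ x → χ₀ (line i ⟪ x ⟫) ≡ colour i
        colour-of zero = trans (cong χ₀ (focused i)) eq
        colour-of (suc x) = coloured i x
      ... | no new = inj₂ record
        { focus = raise L ⟪ zero ⟫ ++ focus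
        ; line = line′
        ; colour = colour′
        ; moving = λ { zero → moving-++ˡ {L = raise L} (Vec.map just focus) (moving-raise {L = L} L-moving)
                     ; (suc i) → moving-++ʳ (raise L) (moving i) }
        ; focused = λ
          { zero → trans (++-⟪⟫ (raise L) _ zero) (cong (raise L ⟪ zero ⟫ ++_) (just-⟪⟫ focus zero))
          ; (suc i) → trans (++-⟪⟫ (raise L) _ zero) (cong (raise L ⟪ zero ⟫ ++_) (focused i)) }
        ; coloured = λ
          { zero x → trans (cong χ (trans (++-⟪⟫ (raise L) _ (suc x))
                       (cong (raise L ⟪ suc x ⟫ ++_) (just-⟪⟫ focus (suc x))))) (χ-raise x focus)
          ; (suc i) x → trans (cong χ (++-⟪⟫ (raise L) (line i) (suc x)))
                          (trans (χ-raise x _) (coloured i x)) }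
        ; colour-injective = colour′-injective }
        where
        open Focused foc
        line′ : Fin (suc k) → VarWord (suc (suc q)) (m + n)
        line′ zero = raise L ++ Vec.map just focus
        line′ (suc i) = raise L ++ line i
        colour′ : Fin (suc k) → Fin c
        colour′ zero = χ₀ focus
        colour′ (suc i) = colour i
        colour′-injective : Injective _≡_ _≡_ colour′
        colour′-injective {zero} {zero} _ = refl
        colour′-injective {zero} {suc j} eq = contradiction (j , eq) new
        colour′-injective {suc i} {zero} eq = contradiction (i , sym eq) new
        colour′-injective {suc i} {suc j} eq = cong suc (colour-injective eq)

  conclusion : ∃ (HalesJewett (suc (suc q)) c)
  conclusion with claim (suc c)
  ... | n , claim-n = n , λ χ → case claim-n χ of λ
    { (inj₁ mono) → mono
    ; (inj₂ foc) → contradiction (injective⇒≤ (Focused.colour-injective foc)) (ℕₚ.<-irrefl refl) }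

halesJewett : ∀ q c → ∃ (HalesJewett q c)
halesJewett zero c = 1 , λ χ → (nothing ∷ []) , (zero , refl) , λ ()
halesJewett (suc zero) c = 1 , λ χ → (nothing ∷ []) , (zero , refl) , λ { zero zero → refl }
halesJewett (suc (suc q)) c = Focusing.conclusion (halesJewett (suc q))

-- Finite types and search over them.

record Finite (A : Set) : Set where
  field
    size    : ℕ
    enc     : A → Fin size
    dec     : Fin size → A
    dec-enc : ∀ a → dec (enc a) ≡ a

  enc-injective : Injective _≡_ _≡_ enc
  enc-injective {a} {b} eq = trans (sym (dec-enc a)) (trans (cong dec eq) (dec-enc b))

open Finite

finite-Fin : ∀ n → Finite (Fin n)
finite-Fin n = record { size = n ; enc = id ; dec = id ; dec-enc = λ _ → refl }

finite-Bool : Finite Bool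
finite-Bool = record
  { size = 2
  ; enc = λ { false → zero ; true → suc zero }
  ; dec = λ { zero → false ; (suc _) → true }
  ; dec-enc = λ { false → refl ; true → refl } }

finite-Maybe : ∀ {A} → Finite A → Finite (Maybe A)
finite-Maybe F = record
  { size = suc (size F)
  ; enc = λ { nothing → zero ; (just a) → suc (enc F a) }
  ; dec = λ { zero → nothing ; (suc i) → just (dec F i) }
  ; dec-enc = λ { nothing → refl ; (just a) → cong just (dec-enc F a) } }

finite-⊎ : ∀ {A B} → Finite A → Finite B → Finite (A ⊎ B)
finite-⊎ F G = record
  { size = size F + size G
  ; enc = λ x → Fin.join (size F) (size G) (Sum.map (enc F) (enc G) x)
  ; dec = λ i → Sum.map (dec F) (dec G) (Fin.splitAt (size F) i)
  ; dec-enc = λ x → trans (cong (Sum.map (dec F) (dec G)) (splitAt-join (size F) (size G) (Sum.map (enc F) (enc G) x))) (retract x) }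
  where
  retract : ∀ x → Sum.map (dec F) (dec G) (Sum.map (enc F) (enc G) x) ≡ x
  retract (inj₁ a) = cong inj₁ (dec-enc F a)
  retract (inj₂ b) = cong inj₂ (dec-enc G b)

finite-× : ∀ {A B} → Finite A → Finite B → Finite (A × B)
finite-× F G = record
  { size = size F * size G
  ; enc = λ (a , b) → Fin.combine (enc F a) (enc G b)
  ; dec = λ i → let p , q = Fin.remQuot (size G) i in dec F p , dec G q
  ; dec-enc = λ (a , b) → trans
      (cong (λ (p , q) → dec F p , dec G q) (remQuot-combine (enc F a) (enc G b)))
      (cong₂ _,_ (dec-enc F a) (dec-enc G b)) }

finite-Vec : ∀ {A} → Finite A → ∀ n → Finite (Vec A n)
finite-Vec F n = record
  { size = size F ^ n
  ; enc = λ v → funToFin (enc F ∘ lookup v)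
  ; dec = λ i → tabulate (dec F ∘ finToFun i)
  ; dec-enc = λ v → trans
      (tabulate-cong (λ i → trans (cong (dec F) (finToFun-funToFin (enc F ∘ lookup v) i)) (dec-enc F _)))
      (tabulate∘lookup v) }

finite-Subset : ∀ n → Finite (Subset n)
finite-Subset = finite-Vec finite-Bool

exists? : ∀ {A : Set} {P : A → Set} → Finite A → (∀ a → Dec (P a)) → Dec (∃ P)
exists? {P = P} F P? = map′ (λ (i , p) → dec F i , p)
  (λ (a , p) → enc F a , subst P (sym (dec-enc F a)) p) (any? (P? ∘ dec F))

-- Injections through prescribed points, and tuples over a sum.

replace : ∀ {r t} (ρ : Fin r → Fin t) → Injective _≡_ _≡_ ρ → ∀ (p : Fin r) (i : Fin t) →
  ∃[ ρ′ ] (Injective _≡_ _≡_ ρ′ × (∃[ a ] ρ′ a ≡ i) × (∀ q → q ≢ p → ρ′ q ≡ ρ q))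
replace {r} {t} ρ inj p i with any? (λ a → ρ a Fin.≟ i)
... | yes hit = ρ , inj , hit , λ _ _ → refl
... | no miss = update , update-injective , (p , at-p) , away
  where
  update : Fin r → Fin t
  update q with q Fin.≟ p
  ... | yes _ = i
  ... | no _ = ρ q
  at-p : update p ≡ i
  at-p with p Fin.≟ p
  ... | yes _ = refl
  ... | no p≢p = contradiction refl p≢p
  away : ∀ q → q ≢ p → update q ≡ ρ q
  away q q≢p with q Fin.≟ p
  ... | yes q≡p = contradiction q≡p q≢p
  ... | no _ = refl
  update-injective : Injective _≡_ _≡_ update
  update-injective {x} {y} eq with x Fin.≟ p | y Fin.≟ p
  ... | yes x≡p | yes y≡p = trans x≡p (sym y≡p)
  ... | yes _ | no _ = contradiction (y , sym eq) miss
  ... | no _ | yes _ = contradiction (x , eq) miss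
  ... | no _ | no _ = inj eq

-- Any two vertices of a clique lie in a common `r`-set, hence in a common edge; `i` and `i′` may
-- coincide. An injection is changed to hit `i`, then changed at a different place to hit `i′`.
through-two : ∀ {r t} → 2 ≤ r → r ≤ t → (i i′ : Fin t) →
  Σ (Fin r → Fin t) λ ρ → Injective _≡_ _≡_ ρ × (∃[ a ] ρ a ≡ i) × (∃[ a ] ρ a ≡ i′)
through-two {suc (suc r)} {t} (s≤s (s≤s _)) r≤t i i′ =
  let ρ₁ , ρ₁-inj , (a , eq) , _ = replace (λ x → Fin.inject≤ x r≤t) (λ {x} {y} → inject≤-injective r≤t r≤t x y) zero i
      ρ₂ , ρ₂-inj , hit , away = replace ρ₁ ρ₁-inj (other a) i′
  in ρ₂ , ρ₂-inj , (a , trans (away a (other≢ a)) eq) , hit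
  where
  other : Fin (suc (suc r)) → Fin (suc (suc r))
  other zero = suc zero
  other (suc _) = zero
  other≢ : ∀ a → a ≢ other a
  other≢ zero ()
  other≢ (suc _) ()

vec-ext : ∀ {A : Set} {n} {u v : Vec A n} → (∀ i → lookup u i ≡ lookup v i) → u ≡ v
vec-ext {u = u} {v} eq = trans (sym (tabulate∘lookup u)) (trans (tabulate-cong eq) (tabulate∘lookup v))

-- Separates the tuples with a private vertex from those lying wholly in the cube or, in the base
-- system, in the copies of `F`.
some-or-all : ∀ {m} {A B : Set} (x : Fin m → A ⊎ B) →
  (∃[ q ] ∃[ b ] x q ≡ inj₂ b) ⊎ (Σ (Fin m → A) λ u → ∀ q → x q ≡ inj₁ (u q))
some-or-all {zero} x = inj₂ ((λ ()) , λ ())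
some-or-all {suc m} x with x zero in eq | some-or-all (x ∘ suc)
... | inj₂ b | _ = inj₁ (zero , b , eq)
... | inj₁ a | inj₁ (q , b , eq′) = inj₁ (suc q , b , eq′)
... | inj₁ a | inj₂ (u , eq′) = inj₂ ((λ { zero → a ; (suc q) → u q }) , λ { zero → eq ; (suc q) → eq′ q })

-- Partite systems of s-sets over n₀ parts.

module Partite {n₀ s k : ℕ} (pos : Fin k → Fin s → Fin n₀)
               (pos-injective : ∀ j → Injective _≡_ _≡_ (pos j)) (r : ℕ) where

  record System : Set₁ where
    field
      V           : Set
      π           : V → Fin n₀
      Edge        : Fin k → Set
      vert        : ∀ {j} → Edge j → Vec V s
      π-vert      : ∀ {j} (h : Edge j) a → π (lookup (vert h) a) ≡ pos j a
      finite-V    : Finite V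
      finite-Edge : ∀ j → Finite (Edge j)

    verts : ∃ Edge → Vec V s
    verts (_ , h) = vert h

    -- Distinct edges may have the same shape; linearity does not forbid this.
    shape : ∃ Edge → Fin k × Vec V s
    shape (j , h) = j , vert h

    Within : ∀ {m} → (Fin m → V) → ∃ Edge → Set
    Within x g = ∀ q → ∃[ a ] lookup (verts g) a ≡ x q

    -- Distinctness is measured by `π`, since projection to a coordinate of the cube preserves the
    -- part of a vertex; within one edge it amounts to distinct vertices.
    Linear : Set
    Linear = (x : Fin r → V) → Injective _≡_ _≡_ (π ∘ x) →
      ∀ g g′ → Within x g → Within x g′ → shape g ≡ shape g′

    Shadow : ∀ {t} → (Fin t → V) → Set
    Shadow {t} y = (ρ : Fin r → Fin t) → Injective _≡_ _≡_ ρ → ∃ (Within (y ∘ ρ))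

    CliquesInEdges : ℕ → Set
    CliquesInEdges t = (y : Fin t → V) → Injective _≡_ _≡_ (π ∘ y) → Shadow y → ∃ (Within y)

    within-shape : ∀ {m} {x : Fin m → V} {g g′} → shape g ≡ shape g′ → Within x g → Within x g′
    within-shape {x = x} eq w q = subst (λ z → ∃[ a ] lookup z a ≡ x q) (cong proj₂ eq) (w q)

    within-unique : ∀ {g a a′ v v′} → lookup (verts g) a ≡ v → lookup (verts g) a′ ≡ v′ → π v ≡ π v′ → v ≡ v′
    within-unique {j , h} {a} {a′} refl refl eq =
      cong (lookup (vert h)) (pos-injective j (trans (sym (π-vert h a)) (trans eq (π-vert h a′))))

  open System

  record Embedding (P Q : System) : Set where
    field
      fun       : V P → V Q
      injective : Injective _≡_ _≡_ fun
      edges     : ∀ {j} (h : Edge P j) → ∃[ h′ ] vert Q {j} h′ ≡ Vec.map fun (vert P h)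

  open Embedding

  MonochromaticOn : ∀ {c} (P Q : System) → (Vec (V Q) s → Fin c) → Embedding P Q → Fin k → Set
  MonochromaticOn P Q χ f j = (h h′ : Edge P j) →
    χ (Vec.map (fun f) (vert P h)) ≡ χ (Vec.map (fun f) (vert P h′))

  -- Amalgamation of copies along the lines of a cube.

  module Amalgamation (P : System) (e : Fin k) (n : ℕ) where

    Key : Set
    Key = Vec (Maybe (Vec (V P) s)) n

    -- Vertices of the cube (the part is stored, as n might be 0), and private vertices of the copies.
    -- The latter carry the key rather than the line: lines through edges of equal shape must give the
    -- same copy, otherwise linearity fails.
    V′ : Set
    V′ = (Fin n₀ × Vec (V P) n) ⊎ (Key × V P)

    -- One coordinate of the cube point of `v`, where `v` lies in part `pos e b`: `v` itself where
    -- the line moves, and where it is fixed the vertex of the fixed edge in the same part.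
    coord : Fin s → V P → Maybe (Vec (V P) s) → V P
    coord b v nothing = v
    coord b v (just f) = lookup f b

    place : Key → (v : V P) → Dec (∃[ b ] pos e b ≡ π P v) → V′
    place K v (yes (b , _)) = inj₁ (π P v , Vec.map (coord b v) K)
    place K v (no _) = inj₂ (K , v)

    emb : Key → V P → V′
    emb K v = place K v (any? (λ b → pos e b Fin.≟ π P v))

    π′ : V′ → Fin n₀
    π′ (inj₁ (p , _)) = p
    π′ (inj₂ (_ , v)) = π P v

    π′-emb : ∀ K v → π′ (emb K v) ≡ π P v
    π′-emb K v with any? (λ b → pos e b Fin.≟ π P v)
    ... | yes _ = refl
    ... | no _ = refl

    emb-inside : ∀ K {v b} → pos e b ≡ π P v → emb K v ≡ inj₁ (π P v , Vec.map (coord b v) K)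
    emb-inside K {v} {b} eq with any? (λ b → pos e b Fin.≟ π P v)
    ... | no outside = contradiction (b , eq) outside
    ... | yes (b′ , eq′) = cong (λ z → inj₁ (π P v , Vec.map (coord z v) K)) (pos-injective e (trans eq′ (sym eq)))

    emb-inside⁻ : ∀ {K v p u} → emb K v ≡ inj₁ (p , u) →
      ∃[ b ] (pos e b ≡ π P v × π P v ≡ p × u ≡ Vec.map (coord b v) K)
    emb-inside⁻ {K} {v} eq with any? (λ b → pos e b Fin.≟ π P v)
    emb-inside⁻ refl | yes (b , eq′) = b , eq′ , refl , refl
    emb-inside⁻ () | no _

    emb-outside⁻ : ∀ {K v K′ v′} → emb K v ≡ inj₂ (K′ , v′) → K ≡ K′ × v ≡ v′
    emb-outside⁻ {K} {v} eq with any? (λ b → pos e b Fin.≟ π P v)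
    emb-outside⁻ () | yes _
    emb-outside⁻ refl | no _ = refl , refl

    -- The second component marks a coordinate that is forced to be variable.
    Line : Set
    Line = Vec (Maybe (Edge P e)) n × Fin n

    skeleton : Line → Vec (Maybe (Edge P e)) n
    skeleton (w , i) = w [ i ]≔ nothing

    key : Line → Key
    key L = Vec.map (Maybe.map (vert P)) (skeleton L)

    Edge′ : Fin k → Set
    Edge′ j = Line × Edge P j

    amalgam : System
    amalgam = record
      { V = V′
      ; π = π′
      ; Edge = Edge′
      ; vert = λ (L , h) → Vec.map (emb (key L)) (vert P h)
      ; π-vert = λ (L , h) a → trans (cong π′ (lookup-map a _ (vert P h)))
          (trans (π′-emb (key L) _) (π-vert P h a))
      ; finite-V = finite-⊎
          (finite-× (finite-Fin n₀) (finite-Vec (finite-V P) n))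
          (finite-× (finite-Vec (finite-Maybe (finite-Vec (finite-V P) s)) n) (finite-V P))
      ; finite-Edge = λ j → finite-×
          (finite-× (finite-Vec (finite-Maybe (finite-Edge P e)) n) (finite-Fin n)) (finite-Edge P j) }

    -- Projection to coordinate `i` of the edge `g` in the copy along `L`: where the line is fixed,
    -- the fixed edge of type `e` takes the place of `g`.
    edgeAt : Line → ∃ (Edge P) → Fin n → ∃ (Edge P)
    edgeAt L g i = maybe′ (e ,_) g (lookup (skeleton L) i)

    edgeAt-moving : ∀ L g → edgeAt L g (proj₂ L) ≡ g
    edgeAt-moving (w , i) g = cong (maybe′ (e ,_) g) (lookup∘update i w nothing)

    edgeAt-type : ∀ L h i → proj₁ (edgeAt L (e , h) i) ≡ e
    edgeAt-type L h i with lookup (skeleton L) i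
    ... | nothing = refl
    ... | just _ = refl

    lookup-coord : ∀ L b v i → lookup (Vec.map (coord b v) (key L)) i
                   ≡ coord b v (Maybe.map (vert P) (lookup (skeleton L) i))
    lookup-coord L b v i = trans (lookup-map i (coord b v) (key L))
      (cong (coord b v) (lookup-map i (Maybe.map (vert P)) (skeleton L)))

    coordinate-∈ : ∀ L g {v p u} → (∃[ a ] lookup (verts P g) a ≡ v) → emb (key L) v ≡ inj₁ (p , u) →
      ∀ i → ∃[ a ] lookup (verts P (edgeAt L g i)) a ≡ lookup u i
    coordinate-∈ L g {v} v∈ eq i with emb-inside⁻ {key L} eq
    ... | b , _ , _ , refl rewrite lookup-coord L b v i with lookup (skeleton L) i
    ... | nothing = v∈
    ... | just f = b , refl

    coordinate-π : ∀ L {v p u} → emb (key L) v ≡ inj₁ (p , u) → ∀ i → π P (lookup u i) ≡ p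
    coordinate-π L {v} eq i with emb-inside⁻ {key L} eq
    ... | b , eq-b , refl , refl rewrite lookup-coord L b v i with lookup (skeleton L) i
    ... | nothing = refl
    ... | just f = trans (π-vert P f b) eq-b

    -- The forced variable coordinate stores `v` itself; hence every copy is embedded injectively
    -- and its cube vertices can be read back.
    coordinate-moving : ∀ L {v p u} → emb (key L) v ≡ inj₁ (p , u) → lookup u (proj₂ L) ≡ v
    coordinate-moving L@(w , i) {v} eq with emb-inside⁻ {key L} eq
    ... | b , _ , _ , refl rewrite lookup-coord L b v i | lookup∘update i w nothing = refl

    emb-injective : ∀ L → Injective _≡_ _≡_ (emb (key L))
    emb-injective L {v} {v′} eq with emb (key L) v in eq-v
    ... | inj₁ _ = trans (sym (coordinate-moving L eq-v)) (coordinate-moving L (sym eq))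
    ... | inj₂ _ = trans (proj₂ (emb-outside⁻ {key L} eq-v)) (sym (proj₂ (emb-outside⁻ {key L} (sym eq))))

    private
      _⟨_⟩ : ∃ Edge′ → Fin n → ∃ (Edge P)
      (j , L , h) ⟨ i ⟩ = edgeAt L (j , h) i

    preimage : ∀ {j L h x} → (∃[ a ] lookup (vert amalgam {j} (L , h)) a ≡ x) →
      ∃[ v ] ((∃[ a ] lookup (vert P h) a ≡ v) × emb (key L) v ≡ x)
    preimage {L = L} {h} (a , eq) = lookup (vert P h) a , (a , refl) , trans (sym (lookup-map a (emb (key L)) (vert P h))) eq

    amalgam-within : ∀ {m} {x : Fin m → V P} {y : Fin m → V′} L g →
      (∀ q → y q ≡ emb (key L) (x q)) → Within P x g → Within amalgam y (proj₁ g , L , proj₂ g)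
    amalgam-within L (j , h) eq w q with w q
    ... | a , eq-a = a , trans (lookup-map a (emb (key L)) (vert P h)) (trans (cong (emb (key L)) eq-a) (sym (eq q)))

    -- A moving coordinate of G shows an edge of its own type j, while a fixed one shows type e. So
    -- for j ≢ e the shapes determine the key, and for j ≡ e they determine the words.
    same-coordinates : ∀ G G′ → (∀ i → shape P (G ⟨ i ⟩) ≡ shape P (G′ ⟨ i ⟩)) →
      shape amalgam G ≡ shape amalgam G′
    same-coordinates G@(j , L , h) G′@(j′ , L′ , h′) same with j Fin.≟ e | j′ Fin.≟ e
    ... | yes refl | yes refl = cong (e ,_) (vec-ext λ a →
      trans (at-type-e L h a) (trans
        (cong (λ z → inj₁ (pos e a , z)) (tabulate-cong λ i → cong (λ z → lookup (proj₂ z) a) (same i)))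
        (sym (at-type-e L′ h′ a))))
      where
      at-type-e : ∀ L (h : Edge P e) a → lookup (Vec.map (emb (key L)) (vert P h)) a ≡
        inj₁ (pos e a , tabulate λ i → lookup (verts P (edgeAt L (e , h) i)) a)
      at-type-e L h a = trans (lookup-map a (emb (key L)) (vert P h)) (trans
        (emb-inside (key L) (sym (π-vert P h a)))
        (cong₂ (λ p u → inj₁ (p , u)) (π-vert P h a) (vec-ext entry)))
        where
        v = lookup (vert P h) a
        entry : ∀ i → lookup (Vec.map (coord a v) (key L)) i ≡
          lookup (tabulate λ i → lookup (verts P (edgeAt L (e , h) i)) a) i
        entry i rewrite lookup∘tabulate (λ i → lookup (verts P (edgeAt L (e , h) i)) a) i
                      | lookup-coord L a v i with lookup (skeleton L) i
        ... | nothing = refl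
        ... | just f = refl
    ... | yes refl | no j′≢e = contradiction (trans
          (cong proj₁ (trans (cong (shape P) (sym (edgeAt-moving L′ (j′ , h′)))) (sym (same (proj₂ L′)))))
          (edgeAt-type L h (proj₂ L′))) j′≢e
    ... | no j≢e | yes refl = contradiction (trans
          (cong proj₁ (trans (cong (shape P) (sym (edgeAt-moving L (j , h)))) (same (proj₂ L))))
          (edgeAt-type L′ h′ (proj₂ L))) j≢e
    ... | no j≢e | no j′≢e = cong₂ (λ K → Product.map₂ (Vec.map (emb K))) key≡ g≡g′
      where
      key≡ : key L ≡ key L′
      key≡ = vec-ext entry
        where
        entry : ∀ i → lookup (key L) i ≡ lookup (key L′) i
        entry i rewrite lookup-map i (Maybe.map (vert P)) (skeleton L)
                      | lookup-map i (Maybe.map (vert P)) (skeleton L′)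
                with lookup (skeleton L) i | lookup (skeleton L′) i | same i
        ... | nothing | nothing | _ = refl
        ... | just _ | just _ | eq = cong (just ∘ proj₂) eq
        ... | nothing | just _ | eq = contradiction (cong proj₁ eq) j≢e
        ... | just _ | nothing | eq = contradiction (cong proj₁ (sym eq)) j′≢e
      g≡g′ : shape P (j , h) ≡ shape P (j′ , h′)
      g≡g′ with edgeAt-moving L (j , h) | same (proj₂ L)
      ... | move | eq rewrite move with lookup (skeleton L′) (proj₂ L)
      ... | nothing = eq
      ... | just _ = contradiction (cong proj₁ eq) j≢e

    coordinate-within : ∀ {m} {x : Fin m → V′} {u : Fin m → Fin n₀ × Vec (V P) n} G → Within amalgam x G → (∀ q → x q ≡ inj₁ (u q)) →
      ∀ i → Within P (λ q → lookup (proj₂ (u q)) i) (G ⟨ i ⟩)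
    coordinate-within (j , L , h) w eq i q with preimage {j} {L} {h} (w q)
    ... | v , v∈ , emb≡ = coordinate-∈ L (j , h) v∈ (trans emb≡ (eq q)) i

    π-coordinate : ∀ {m} {x : Fin m → V′} {u : Fin m → Fin n₀ × Vec (V P) n} G → Within amalgam x G → (∀ q → x q ≡ inj₁ (u q)) →
      ∀ i q → π P (lookup (proj₂ (u q)) i) ≡ π′ (x q)
    π-coordinate (j , L , h) w eq i q with preimage {j} {L} {h} (w q)
    ... | v , _ , emb≡ = trans (coordinate-π L (trans emb≡ (eq q)) i) (sym (cong π′ (eq q)))

    injective-≗ : ∀ {A B : Set} {f g : A → B} → (∀ x → f x ≡ g x) → Injective _≡_ _≡_ g → Injective _≡_ _≡_ f
    injective-≗ f≗g inj eq = inj (trans (sym (f≗g _)) (trans eq (f≗g _)))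

    same-key : ∀ {m} {x : Fin m → V′} {q K v} j L h → Within amalgam x (j , L , h) → x q ≡ inj₂ (K , v) →
      key L ≡ K
    same-key {q = q} j L h w eq with preimage {j} {L} {h} (w q)
    ... | _ , _ , emb≡ = proj₁ (emb-outside⁻ {key L} (trans emb≡ eq))

    -- If the common `r` vertices all lie in the cube, linearity of `P` applies in every coordinate.
    -- Otherwise a private vertex reveals the key, so both edges lie in the same copy and can be
    -- pulled back to `P`.
    amalgam-linear : Linear P → Linear amalgam
    amalgam-linear lin x inj G@(j , L , h) G′@(j′ , L′ , h′) w w′ with some-or-all x
    ... | inj₂ (u , eq) = same-coordinates G G′ λ i →
      lin _ (injective-≗ (π-coordinate G w eq i) inj) (G ⟨ i ⟩) (G′ ⟨ i ⟩)
        (coordinate-within G w eq i) (coordinate-within G′ w′ eq i)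
    ... | inj₁ (q , (K , _) , eq) =
      cong₂ (λ K → Product.map₂ (Vec.map (emb K))) key≡
        (lin v v-inj (j , h) (j′ , h′) (proj₁ ∘ proj₂ ∘ pre) λ q′ → Product.map₂ (λ eq → trans eq (sym (v≡v′ q′))) (proj₁ (proj₂ (pre′ q′))))
      where
      key≡ : key L ≡ key L′
      key≡ = trans (same-key j L h w eq) (sym (same-key j′ L′ h′ w′ eq))
      pre = λ q → preimage {j} {L} {h} (w q)
      pre′ = λ q → preimage {j′} {L′} {h′} (w′ q)
      v = proj₁ ∘ pre
      v≡v′ : ∀ q → v q ≡ proj₁ (pre′ q)
      v≡v′ q = emb-injective L (trans (proj₂ (proj₂ (pre q)))
        (trans (sym (proj₂ (proj₂ (pre′ q)))) (cong (λ K → emb K _) (sym key≡))))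
      v-inj : Injective _≡_ _≡_ (π P ∘ v)
      v-inj = injective-≗ (λ q → trans (sym (π′-emb (key L) (v q))) (cong π′ (proj₂ (proj₂ (pre q))))) inj

    -- A clique inside the cube is a clique in every coordinate, and linearity shows that a single
    -- edge of the amalgam has the projections found there. A clique with a private vertex lies in a
    -- single copy of `P`.
    amalgam-cliques : ∀ {t} → 2 ≤ r → r ≤ t → Linear P → CliquesInEdges P t → CliquesInEdges amalgam t
    amalgam-cliques {t} 2≤r r≤t lin clique y inj shadow with some-or-all y
    ... | inj₂ (u , eq) = conclude
      where
      z : Fin n → Fin t → V P
      z i q = lookup (proj₂ (u q)) i

      z-π : ∀ i q → π P (z i q) ≡ π′ (y q)
      z-π i q with through-two 2≤r r≤t q q
      ... | ρ , ρ-inj , (a , refl) , _ with shadow ρ ρ-inj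
      ... | G , w = π-coordinate G w (eq ∘ ρ) i a

      in-e : ∀ q → ∃[ b ] pos e b ≡ π′ (y q)
      in-e q with through-two 2≤r r≤t q q
      ... | ρ , ρ-inj , (a , refl) , _ with shadow ρ ρ-inj
      ... | (j , L , h) , w with preimage {j} {L} {h} (w a)
      ... | v , _ , emb≡ with emb-inside⁻ {key L} (trans emb≡ (eq (ρ a)))
      ... | b , eq-b , eq-p , _ = b , trans eq-b (trans eq-p (sym (cong π′ (eq (ρ a)))))

      clique-at : ∀ i → ∃ (Within P (z i))
      clique-at i = clique (z i) (injective-≗ (z-π i) inj) λ ρ ρ-inj →
        let G , w = shadow ρ ρ-inj in G ⟨ i ⟩ , coordinate-within G w (eq ∘ ρ) i

      conclude : ∃ (Within amalgam y)
      -- The edge `G` through the first `r` vertices will contain all of `y`: in each coordinate its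
      -- projection shares `r` vertices with the edge that contains the projected clique.
      conclude with shadow (λ x → Fin.inject≤ x r≤t) (λ {a} {b} → inject≤-injective r≤t r≤t a b)
      ... | G@(j , L , h) , w = G , all-in
        where
        z-in : ∀ i → Within P (z i) (G ⟨ i ⟩)
        z-in i = let g , w′ = clique-at i in within-shape P {g = g} {G ⟨ i ⟩}
          (lin (z i ∘ λ x → Fin.inject≤ x r≤t)
               (λ {a} {b} e → inject≤-injective r≤t r≤t a b (injective-≗ (z-π i) inj e))
               g (G ⟨ i ⟩) (λ q → w′ (Fin.inject≤ q r≤t)) (coordinate-within G w (λ q → eq (Fin.inject≤ q r≤t)) i)) w′
        i₀ = proj₂ L
        -- The moving coordinate shows which vertex of `h` to take. Its image agrees with `y q` in
        -- every coordinate, because an edge meets each part at most once.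
        all-in : Within amalgam y G
        all-in q with subst (λ g → ∃[ a ] lookup (verts P g) a ≡ z i₀ q) (edgeAt-moving L (j , h)) (z-in i₀ q) | in-e q
        ... | a , eq-a | b , eq-b = a , trans (lookup-map a (emb (key L)) (vert P h)) (trans (cong (emb (key L)) eq-a)
          (trans v-emb (trans (cong inj₁ (cong₂ _,_ π-v (vec-ext entry))) (sym (eq q)))))
          where
          v = z i₀ q
          π-v : π P v ≡ proj₁ (u q)
          π-v = trans (z-π i₀ q) (cong π′ (eq q))
          v-emb : emb (key L) v ≡ inj₁ (π P v , Vec.map (coord b v) (key L))
          v-emb = emb-inside (key L) (trans eq-b (sym (z-π i₀ q)))
          entry : ∀ i → lookup (Vec.map (coord b v) (key L)) i ≡ z i q
          entry i = within-unique P {G ⟨ i ⟩} (proj₂ (coordinate-∈ L (j , h) (a , eq-a) v-emb i)) (proj₂ (z-in i q))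
            (trans (coordinate-π L v-emb i) (trans (z-π i₀ q) (sym (z-π i q))))
    ... | inj₁ (q₀ , (K , v₀) , eq₀) = conclude
      where
      -- Each vertex shares an `r`-set with the private vertex `y q₀`, whose key fixes the copy.
      through : ∀ q → ∃[ L ] ∃[ v ] (key L ≡ K × emb (key L) v ≡ y q)
      through q with through-two 2≤r r≤t q₀ q
      ... | ρ , ρ-inj , (a₀ , refl) , (a , refl) with shadow ρ ρ-inj
      ... | (j , L , h) , w with preimage {j} {L} {h} (w a)
      ... | v , _ , emb≡ = L , v , same-key {q = a₀} j L h w eq₀ , emb≡

      L₀ = proj₁ (through q₀)
      key₀ : key L₀ ≡ K
      key₀ = proj₁ (proj₂ (proj₂ (through q₀)))
      v : Fin t → V P
      v q = proj₁ (proj₂ (through q))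
      emb-v : ∀ q → y q ≡ emb (key L₀) (v q)
      emb-v q = let L , _ , key≡ , emb≡ = through q in
        trans (sym emb≡) (cong (λ K → emb K (v q)) (trans key≡ (sym key₀)))

      v-shadow : Shadow P v
      v-shadow ρ ρ-inj with shadow ρ ρ-inj
      ... | G@(j , L , h) , w with some-or-all (y ∘ ρ)
      -- An `r`-set inside the cube may come from an edge of another copy; projecting to the moving
      -- coordinate of `L₀` returns its vertices to those of `v`.
      ... | inj₂ (u , eq) = G ⟨ proj₂ L₀ ⟩ , λ q → Product.map₂
        (λ e → trans e (coordinate-moving L₀ (trans (sym (emb-v (ρ q))) (eq q))))
        (coordinate-within G w eq (proj₂ L₀) q)
      ... | inj₁ (q₁ , (K₁ , _) , eq₁) = (j , h) , λ q →
        let x , x∈ , emb≡ = preimage {j} {L} {h} (w q) in Product.map₂ (λ e → trans e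
          (emb-injective L₀ (trans (cong (λ K → emb K x) (sym key≡)) (trans emb≡ (emb-v (ρ q)))))) x∈
        where
        key≡ : key L ≡ key L₀
        key≡ = trans (same-key j L h w eq₁)
          (sym (proj₁ (emb-outside⁻ {key L₀} (trans (sym (emb-v (ρ q₁))) eq₁))))

      conclude : ∃ (Within amalgam y)
      conclude with clique v (injective-≗ (λ q → trans (sym (π′-emb (key L₀) (v q))) (cong π′ (sym (emb-v q)))) inj) v-shadow
      ... | g , w = _ , amalgam-within L₀ g emb-v w

    line-embedding : Line → Embedding P amalgam
    line-embedding L = record
      { fun = emb (key L) ; injective = emb-injective L ; edges = λ h → (L , h) , refl }

  -- Hales-Jewett for the edges of one type.

  module _ {c : ℕ} (P : System) (e : Fin k) where
    open Finite (finite-Edge P e) renaming (size to q; enc to encₑ; dec to decₑ; dec-enc to dec-encₑ)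

    dimension : ℕ
    dimension = proj₁ (halesJewett q c)

    open Amalgamation P e dimension

    word : Word q dimension → Vec V′ s
    word w = tabulate λ a → inj₁ (pos e a , Vec.map (λ l → lookup (vert P (decₑ l)) a) w)

    -- Along a combinatorial line, the image of an edge `h` of type `e` is the word obtained by
    -- putting `h` for the variable. So a monochromatic line yields a copy of `P` on which type `e`
    -- is monochromatic.
    amalgam-ramsey : (χ : Vec V′ s → Fin c) →
      Σ (Embedding P amalgam) λ f → MonochromaticOn P amalgam χ f e
    amalgam-ramsey χ with proj₂ (halesJewett q c) (χ ∘ word)
    ... | M , (i , M-i) , mono = line-embedding L , λ h h′ →
      trans (cong χ (emb≡word h)) (trans (mono (encₑ h) (encₑ h′)) (sym (cong χ (emb≡word h′))))
      where
      L : Line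
      -- The coordinate `i` is variable in `M` already, so forcing it in `skeleton` changes nothing.
      L = Vec.map (Maybe.map decₑ) M , i
      skeleton-L : ∀ i′ → lookup (skeleton L) i′ ≡ Maybe.map decₑ (lookup M i′)
      skeleton-L i′ = trans (cong (λ w → lookup w i′) (trans
          (cong (λ z → Vec.map (Maybe.map decₑ) M [ i ]≔ z) (sym (trans (lookup-map i _ M) (cong (Maybe.map decₑ) M-i))))
          ([]≔-lookup (Vec.map (Maybe.map decₑ) M) i))) (lookup-map i′ _ M)
      emb≡word : ∀ h → Vec.map (emb (key L)) (vert P h) ≡ word (M ⟪ encₑ h ⟫)
      emb≡word h = vec-ext λ a → trans (lookup-map a (emb (key L)) (vert P h)) (trans
        (emb-inside (key L) (sym (π-vert P h a)))
        (trans (cong₂ (λ p u → inj₁ (p , u)) (π-vert P h a) (vec-ext (entry a)))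
        (sym (lookup∘tabulate _ a))))
        where
        entry : ∀ a i′ → lookup (Vec.map (coord a (lookup (vert P h) a)) (key L)) i′ ≡
          lookup (Vec.map (λ l → lookup (vert P (decₑ l)) a) (M ⟪ encₑ h ⟫)) i′
        entry a i′ rewrite lookup-coord L a (lookup (vert P h) a) i′ | skeleton-L i′
          | lookup-map i′ (λ l → lookup (vert P (decₑ l)) a) (M ⟪ encₑ h ⟫)
          | lookup-map i′ (fromMaybe (encₑ h)) M with lookup M i′
        ... | nothing = cong (λ h → lookup (vert P h) a) (sym (dec-encₑ h))
        ... | just _ = refl

  -- Iteration over the types.

  record Sparse (t₀ : ℕ) (P : System) : Set where
    field
      linear  : Linear P
      cliques : ∀ {t} → t₀ ≤ t → CliquesInEdges P t

  -- The type `e` is amalgamated first, but its monochromatic copy is chosen last: `js` is handled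
  -- in a system built from the amalgam, and the colouring is pulled back along the resulting
  -- embedding `f`. Passing to the subcopy `g` keeps the types in `js` monochromatic, since `g` maps
  -- edges to edges of the same type.
  partite-construction : ∀ {t₀} c → 2 ≤ r → r ≤ t₀ → (js : List (Fin k)) (P : System) → Sparse t₀ P →
    Σ System λ Q → Sparse t₀ Q × ((χ : Vec (V Q) s → Fin c) →
      Σ (Embedding P Q) λ f → ∀ {j} → j ∈ˡ js → MonochromaticOn P Q χ f j)
  partite-construction c 2≤r r≤t₀ [] P sparse = P , sparse , λ χ → record
    { fun = id ; injective = id ; edges = λ h → h , sym (map-id (vert P h)) } , λ ()
  partite-construction {t₀} c 2≤r r≤t₀ (e ∷ js) P sparse
    with partite-construction c 2≤r r≤t₀ js (Amalgamation.amalgam P e (dimension {c} P e)) record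
      { linear = Amalgamation.amalgam-linear P e _ (Sparse.linear sparse)
      ; cliques = λ t₀≤t → Amalgamation.amalgam-cliques P e _ 2≤r (ℕₚ.≤-trans r≤t₀ t₀≤t)
          (Sparse.linear sparse) (Sparse.cliques sparse t₀≤t) }
  ... | Q , sparse-Q , ramsey-Q = Q , sparse-Q , λ χ → compose χ (ramsey-Q χ)
    where
    open Amalgamation P e (dimension {c} P e) using (amalgam)
    compose : (χ : Vec (V Q) s → Fin c) →
      (Σ (Embedding amalgam Q) λ f → ∀ {j} → j ∈ˡ js → MonochromaticOn amalgam Q χ f j) →
      Σ (Embedding P Q) λ f → ∀ {j} → j ∈ˡ (e ∷ js) → MonochromaticOn P Q χ f j
    compose χ (f , f-mono) with amalgam-ramsey P e (χ ∘ Vec.map (fun f))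
    ... | g , g-mono = record
      { fun = fun f ∘ fun g
      ; injective = injective g ∘ injective f
      ; edges = λ h → let h₁ , eq₁ = edges g h ; h₂ , eq₂ = edges f h₁ in
          h₂ , trans eq₂ (trans (cong (Vec.map (fun f)) eq₁) (sym (map-∘ (fun f) (fun g) (vert P h)))) }
      , λ { (here refl) h h′ → trans (cong χ (map-∘ (fun f) (fun g) (vert P h)))
              (trans (g-mono h h′) (sym (cong χ (map-∘ (fun f) (fun g) (vert P h′)))))
          ; (there j∈) h h′ → let h₁ , eq₁ = edges g h ; h₂ , eq₂ = edges g h′ in
              trans (cong χ (trans (map-∘ (fun f) (fun g) (vert P h)) (cong (Vec.map (fun f)) (sym eq₁))))
              (trans (f-mono j∈ h₁ h₂)
              (sym (cong χ (trans (map-∘ (fun f) (fun g) (vert P h′)) (cong (Vec.map (fun f)) (sym eq₂)))))) }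

  -- The base system: for every φ : V(F) → [n₀] and every J prescribing the type of the
  -- edges of F, a copy of F whose edge S is extended to an edge of type J S by private vertices.
  -- An edge that does not fit its type consists of private vertices only.
  module Base (F : Graph r) where

    nF : ℕ
    nF = Graph.n F

    Ω : Set
    Ω = Vec (Fin n₀) nF × Vec (Maybe (Fin k)) (size (finite-Subset nF))

    V₀ : Set
    V₀ = (Ω × Fin nF) ⊎ (Ω × Subset nF × Fin k × Fin s)

    typeOf : Ω → Subset nF → Maybe (Fin k)
    typeOf (_ , J) S = lookup J (enc (finite-Subset nF) S)

    π₀ : V₀ → Fin n₀
    π₀ (inj₁ ((φ , _) , u)) = lookup φ u
    π₀ (inj₂ (_ , _ , j , a)) = pos j a

    Core : Ω → Subset nF → Fin k → Fin s → Set
    Core ω S j a = T (Graph.E F S) × typeOf ω S ≡ just j × ∃[ u ] (u ∈ S × lookup (proj₁ ω) u ≡ pos j a)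

    core? : ∀ ω S j a → Dec (Core ω S j a)
    core? ω S j a = T? _ ×-dec (Maybeₚ.≡-dec Fin._≟_ (typeOf ω S) (just j) ×-dec
      any? (λ u → u ∈? S ×-dec (lookup (proj₁ ω) u Fin.≟ pos j a)))

    vertex : Ω → Subset nF → Fin k → Fin s → V₀
    vertex ω S j a with core? ω S j a
    ... | yes (_ , _ , u , _) = inj₁ (ω , u)
    ... | no _ = inj₂ (ω , S , j , a)

    π-vertex : ∀ ω S j a → π₀ (vertex ω S j a) ≡ pos j a
    π-vertex ω S j a with core? ω S j a
    ... | yes (_ , _ , _ , _ , eq) = eq
    ... | no _ = refl

    -- The search may find another vertex `u′` of `S` in the same part; the two are identified only
    -- later, for an injective map to the parts.
    vertex-core⁺ : ∀ {ω S j a u} → T (Graph.E F S) → typeOf ω S ≡ just j → u ∈ S → lookup (proj₁ ω) u ≡ pos j a →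
      ∃[ u′ ] (u′ ∈ S × lookup (proj₁ ω) u′ ≡ pos j a × vertex ω S j a ≡ inj₁ (ω , u′))
    vertex-core⁺ {ω} {S} {j} {a} {u} ES type u∈ eq with core? ω S j a
    ... | yes (_ , _ , u′ , u′∈ , eq′) = u′ , u′∈ , eq′ , refl
    ... | no not-core = contradiction (ES , type , u , u∈ , eq) not-core

    vertex-core⁻ : ∀ {ω S j a ω′ u} → vertex ω S j a ≡ inj₁ (ω′ , u) →
      ω ≡ ω′ × T (Graph.E F S) × typeOf ω S ≡ just j × u ∈ S
    vertex-core⁻ {ω} {S} {j} {a} eq with core? ω S j a
    vertex-core⁻ refl | yes (ES , type , u , u∈ , _) = refl , ES , type , u∈
    vertex-core⁻ () | no _

    vertex-private⁻ : ∀ {ω S j a ω′ S′ j′ a′} → vertex ω S j a ≡ inj₂ (ω′ , S′ , j′ , a′) →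
      (j , ω , S) ≡ (j′ , ω′ , S′)
    vertex-private⁻ {ω} {S} {j} {a} eq with core? ω S j a
    vertex-private⁻ () | yes _
    vertex-private⁻ refl | no _ = refl

    base : System
    base = record
      { V = V₀
      ; π = π₀
      ; Edge = λ _ → Ω × Subset nF
      ; vert = λ {j} (ω , S) → tabulate (vertex ω S j)
      ; π-vert = λ {j} (ω , S) a → trans (cong π₀ (lookup∘tabulate (vertex ω S j) a)) (π-vertex ω S j a)
      ; finite-V = finite-⊎ (finite-× finite-Ω (finite-Fin nF))
          (finite-× finite-Ω (finite-× (finite-Subset nF) (finite-× (finite-Fin k) (finite-Fin s))))
      ; finite-Edge = λ _ → finite-× finite-Ω (finite-Subset nF) }
      where
      finite-Ω : Finite Ω
      finite-Ω = finite-× (finite-Vec (finite-Fin n₀) nF) (finite-Vec (finite-Maybe (finite-Fin k)) _)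

    within-vertex : ∀ {m} {x : Fin m → V₀} {j ω S} → Within base x (j , ω , S) → ∀ q → ∃[ a ] vertex ω S j a ≡ x q
    within-vertex {j = j} {ω} {S} w q = let a , eq = w q in a , trans (sym (lookup∘tabulate (vertex ω S j) a)) eq

    within-private : ∀ {m} {x : Fin m → V₀} {j ω S q ω′ S′ j′ a′} → Within base x (j , ω , S) →
      x q ≡ inj₂ (ω′ , S′ , j′ , a′) → (j , ω , S) ≡ (j′ , ω′ , S′)
    within-private {j = j} {ω} {S} {q} w eq = vertex-private⁻ {ω} {S} {j} (trans (proj₂ (within-vertex w q)) eq)

    within-core : ∀ {m} {x : Fin m → V₀} {u : Fin m → Ω × Fin nF} {j ω S} → Within base x (j , ω , S) →
      (∀ q → x q ≡ inj₁ (u q)) → ∀ q → ω ≡ proj₁ (u q) × T (Graph.E F S) × typeOf ω S ≡ just j × proj₂ (u q) ∈ S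
    within-core {j = j} {ω} {S} w eq q = vertex-core⁻ {ω} {S} {j} (trans (proj₂ (within-vertex w q)) (eq q))

    edge-≡-image : ∀ {S} {u : Fin r → Fin nF} → Injective _≡_ _≡_ u → T (Graph.E F S) → (∀ q → u q ∈ S) → image u ⊤ ≡ S
    edge-≡-image {S} {u} inj ES u∈ = ⊆∧∣≡∣⇒≡
      (λ z∈ → let q , _ , eq = image-∈⁻ u ⊤ z∈ in subst (_∈ S) eq (u∈ q))
      (trans (⊤-∣image∣ inj) (sym (Graph.uniform F S ES)))

    -- A private vertex records its edge entirely. Otherwise the `r` vertices belong to one copy and
    -- fill the edge `S` of `F`, and `typeOf` returns the type.
    base-linear : 2 ≤ r → Linear base
    base-linear 2≤r x inj (j , ω , S) (j′ , ω′ , S′) w w′ with some-or-all x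
    ... | inj₁ (q , _ , eq) = cong (shape base) (trans (within-private w eq) (sym (within-private w′ eq)))
    ... | inj₂ (u , eq) = same (just-injective (trans (sym type₀) (trans (cong₂ typeOf ω≡ω′ S≡S′) type₀′))) ω≡ω′ S≡S′
      where
      q₀ : Fin r
      q₀ = Fin.fromℕ< (ℕₚ.≤-trans (s≤s z≤n) 2≤r)
      type₀ = proj₁ (proj₂ (proj₂ (within-core w eq q₀)))
      type₀′ = proj₁ (proj₂ (proj₂ (within-core w′ eq q₀)))
      ω≡ : ∀ q → ω ≡ proj₁ (u q)
      ω≡ q = proj₁ (within-core w eq q)
      ω≡ω′ : ω ≡ ω′
      ω≡ω′ = trans (ω≡ q₀) (sym (proj₁ (within-core w′ eq q₀)))
      u-inj : Injective _≡_ _≡_ (proj₂ ∘ u)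
      u-inj {p} {q} e = inj (cong π₀ (trans (eq p) (trans (cong inj₁ (cong₂ _,_ (trans (sym (ω≡ p)) (ω≡ q)) e)) (sym (eq q)))))
      S≡S′ : S ≡ S′
      S≡S′ = trans
        (sym (edge-≡-image u-inj (proj₁ (proj₂ (within-core w eq q₀))) (λ q → proj₂ (proj₂ (proj₂ (within-core w eq q))))))
        (edge-≡-image u-inj (proj₁ (proj₂ (within-core w′ eq q₀))) (λ q → proj₂ (proj₂ (proj₂ (within-core w′ eq q)))))
      same : j ≡ j′ → ω ≡ ω′ → S ≡ S′ → shape base (j , ω , S) ≡ shape base (j′ , ω′ , S′)
      same refl refl refl = refl

    -- Every vertex of a clique shares an edge with a given private vertex, which determines that
    -- edge; without private vertices the clique would be one of `F`.
    base-cliques : ∀ {t} → 2 ≤ r → r ≤ t →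
      (∀ (u : Fin t → Fin nF) → Injective _≡_ _≡_ u →
        ¬ ((ρ : Fin r → Fin t) → Injective _≡_ _≡_ ρ → T (Graph.E F (image (u ∘ ρ) ⊤)))) →
      CliquesInEdges base t
    base-cliques {t} 2≤r r≤t no-clique y inj shadow with some-or-all y
    ... | inj₁ (q₀ , (ω , S , j , a) , eq₀) = (j , ω , S) , within
      where
      within : Within base y (j , ω , S)
      within q with through-two 2≤r r≤t q₀ q
      ... | ρ , ρ-inj , (b₀ , refl) , (b , refl) with shadow ρ ρ-inj
      ... | G , w = subst (λ G → ∃[ a ] lookup (verts base G) a ≡ y (ρ b)) (within-private {q = b₀} w eq₀) (w b)
    ... | inj₂ (u , eq) = contradiction clique (no-clique (proj₂ ∘ u) u-inj)
      where
      ω≡ : ∀ p q → proj₁ (u p) ≡ proj₁ (u q)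
      ω≡ p q with through-two 2≤r r≤t p q
      ... | ρ , ρ-inj , (a , refl) , (b , refl) with shadow ρ ρ-inj
      ... | _ , w = trans (sym (proj₁ (within-core w (eq ∘ ρ) a))) (proj₁ (within-core w (eq ∘ ρ) b))
      u-inj : Injective _≡_ _≡_ (proj₂ ∘ u)
      u-inj {p} {q} e = inj (cong π₀ (trans (eq p) (trans (cong inj₁ (cong₂ _,_ (ω≡ p q) e)) (sym (eq q)))))
      clique : (ρ : Fin r → Fin t) → Injective _≡_ _≡_ ρ → T (Graph.E F (image (proj₂ ∘ u ∘ ρ) ⊤))
      clique ρ ρ-inj with shadow ρ ρ-inj
      ... | (j , ω , S) , w = subst (T ∘ Graph.E F)
        (sym (edge-≡-image (ρ-inj ∘ u-inj) ES (λ q → proj₂ (proj₂ (proj₂ (core q)))))) ES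
        where
        core = within-core w (eq ∘ ρ)
        ES = proj₁ (proj₂ (core (Fin.fromℕ< (ℕₚ.≤-trans (s≤s z≤n) 2≤r))))

  -- The r-shadow of a system and its arrow relations.

  module Shadow (Q : System) where

    number : Vec (V Q) s → Fin s → Fin (size (finite-V Q))
    number x = enc (finite-V Q) ∘ lookup x

    vert-injective : ∀ {j} (h : Edge Q j) → Injective _≡_ _≡_ (lookup (vert Q h))
    vert-injective {j} h {a} {b} eq = pos-injective j
      (trans (sym (π-vert Q h a)) (trans (cong (π Q) eq) (π-vert Q h b)))

    number-injective : ∀ {j} (h : Edge Q j) → Injective _≡_ _≡_ (number (vert Q h))
    number-injective h eq = vert-injective h (enc-injective (finite-V Q) eq)

    IsEdge : Subset (size (finite-V Q)) → Set
    IsEdge S = ∃[ j ] Σ (Edge Q j) λ h → ∃[ R ] (∣ R ∣ ≡ r × image (number (vert Q h)) R ≡ S)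

    abstract
      edge? : ∀ S → Dec (IsEdge S)
      edge? S = any? λ j → exists? (finite-Edge Q j) λ h → exists? (finite-Subset s) λ R →
        (∣ R ∣ ℕₚ.≟ r) ×-dec ≡-dec Bool._≟_ (image (number (vert Q h)) R) S

    shadow : Graph r
    shadow = record
      { n = size (finite-V Q)
      ; E = λ S → does (edge? S)
      ; uniform = λ S ES → let _ , h , R , R-r , eq = does⇒ (edge? S) ES in
          trans (cong ∣_∣ (sym eq)) (trans (∣image∣ (number-injective h) R) R-r) }

    is-edge⁺ : ∀ {S} → IsEdge S → T (does (edge? S))
    is-edge⁺ {S} edge = Equivalence.from T-≡ (dec-true (edge? S) edge)

    module _ {t : ℕ} (2≤r : 2 ≤ r) (r≤t : r ≤ t) (linear : Linear Q) (cliques : CliquesInEdges Q t)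
             (φ : Fin t → Fin (size (finite-V Q))) (φ-inj : Injective _≡_ _≡_ φ) where

      private
        Over : Subset t → Subset s → Set
        Over S R = ∃[ j ] Σ (Edge Q j) λ h → image (number (vert Q h)) R ≡ image φ S

        vertex-over : ∀ {S R q} → Over S R → q ∈ S → ∃[ v ] enc (finite-V Q) v ≡ φ q
        vertex-over {S} {R} {q} (j , h , eq) q∈ =
          let a , _ , eq′ = image-∈⁻ (number (vert Q h)) R (subst (φ q ∈_) (sym eq) (image-∈⁺ φ q∈))
          in lookup (vert Q h) a , eq′

        -- `Rs S` records the positions of `image φ S` in an edge that may vary with `S`. The whole
        -- clique lies in one edge `g`, and by linearity each of those edges has the same vertex
        -- tuple as `g`, so all the positions come from one injection `θ`.
        pull : (y : Fin t → V Q) → (∀ q → enc (finite-V Q) (y q) ≡ φ q) →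
          (Rs : Subset t → Subset s) → (∀ S → ∣ S ∣ ≡ r → Over S (Rs S)) →
          Σ (Fin t → Fin s) λ θ → Injective _≡_ _≡_ θ × (∀ S → ∣ S ∣ ≡ r → image θ S ≡ Rs S)
        pull y enc-y Rs over = from-clique (cliques y πy-inj within)
          where
          y-inj : Injective _≡_ _≡_ y
          y-inj {p} {q} e = φ-inj (trans (sym (enc-y p)) (trans (cong (enc (finite-V Q)) e) (enc-y q)))
          y-in : ∀ {S} (o : Over S (Rs S)) {q} → q ∈ S → ∃[ a ] lookup (vert Q (proj₁ (proj₂ o))) a ≡ y q
          y-in {S} (j , h , eq) {q} q∈ =
            let a , _ , eq′ = image-∈⁻ (number (vert Q h)) (Rs S) (subst (φ q ∈_) (sym eq) (image-∈⁺ φ q∈))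
            in a , enc-injective (finite-V Q) (trans eq′ (sym (enc-y q)))
          within : (ρ : Fin r → Fin t) → Injective _≡_ _≡_ ρ → ∃ (Within Q (y ∘ ρ))
          within ρ ρ-inj = let o = over (image ρ ⊤) (⊤-∣image∣ ρ-inj) in
            (proj₁ o , proj₁ (proj₂ o)) , λ q → y-in o (image-∈⁺ ρ ∈⊤)
          -- Any two vertices of the clique lie in a common edge, so distinct ones lie in different
          -- parts.
          πy-inj : Injective _≡_ _≡_ (π Q ∘ y)
          πy-inj {p} {q} e =
            let ρ , ρ-inj , (a , eq) , (b , eq′) = through-two 2≤r r≤t p q
                G , w = within ρ ρ-inj
            in y-inj (within-unique Q {G} (trans (proj₂ (w a)) (cong y eq)) (trans (proj₂ (w b)) (cong y eq′)) e)
          from-clique : ∃ (Within Q y) →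
            Σ (Fin t → Fin s) λ θ → Injective _≡_ _≡_ θ × (∀ S → ∣ S ∣ ≡ r → image θ S ≡ Rs S)
          from-clique (g , w) = θ , θ-inj , λ S S-r → same S S-r (over S S-r) (enumeration r S S-r)
            where
            θ : Fin t → Fin s
            θ = proj₁ ∘ w
            θ-inj : Injective _≡_ _≡_ θ
            θ-inj {p} {q} e = y-inj (trans (sym (proj₂ (w p))) (trans (cong (lookup (verts Q g)) e) (proj₂ (w q))))
            same : ∀ S → ∣ S ∣ ≡ r → Over S (Rs S) → (∃[ ρ ] Enumerates {r} ρ S) → image θ S ≡ Rs S
            same S S-r o@(j , h , eq) (ρ , ρ-inj , ρ∈ , _) = image-injective (number-injective (proj₂ g)) (begin
              image (number (verts Q g)) (image θ S)    ≡⟨ image-∘ (number (verts Q g)) θ S ⟨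
              image (number (verts Q g) ∘ θ) S          ≡⟨ image-cong (λ q → trans (cong (enc (finite-V Q)) (proj₂ (w q))) (enc-y q)) S ⟩
              image φ S                                 ≡⟨ eq ⟨
              image (number (vert Q h)) (Rs S)          ≡⟨ cong (λ x → image (number x) (Rs S)) vert≡ ⟩
              image (number (verts Q g)) (Rs S)         ∎)
              where
              open ≡-Reasoning
              vert≡ : vert Q h ≡ verts Q g
              vert≡ = cong proj₂ (linear (y ∘ ρ) (ρ-inj ∘ πy-inj) (j , h) g (λ q → y-in o (ρ∈ q)) (w ∘ ρ))

      copy-in-edge : (Rs : Subset t → Subset s) → (∀ S → ∣ S ∣ ≡ r → Over S (Rs S)) →
        Σ (Fin t → Fin s) λ θ → Injective _≡_ _≡_ θ × (∀ S → ∣ S ∣ ≡ r → image θ S ≡ Rs S)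
      copy-in-edge Rs over = pull (proj₁ ∘ pick) (proj₂ ∘ pick) Rs over
        where
        pick : ∀ q → ∃[ v ] enc (finite-V Q) v ≡ φ q
        pick q =
          let ρ , ρ-inj , (a , eq) , _ = through-two 2≤r r≤t q q
          in vertex-over {R = Rs (image ρ ⊤)} (over (image ρ ⊤) (⊤-∣image∣ ρ-inj)) (subst (_∈ image ρ ⊤) eq (image-∈⁺ ρ ∈⊤))

    -- Colour the r-subsets of each edge as in a given colouring of the r-subsets of [s].
    shadow-arrows⁻ : ∀ {t₀ ℓ} → 2 ≤ r → r ≤ t₀ → Sparse t₀ Q → (t : Fin ℓ → ℕ) → (∀ i → t₀ ≤ t i) →
      Arrows shadow (λ i → K r (t i)) → Arrows (K r s) (λ i → K r (t i))
    shadow-arrows⁻ {ℓ = ℓ} 2≤r r≤t₀ sparse t t₀≤ arrows c = transfer (arrows (c ∘ trace))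
      where
      open Sparse sparse
      trace-at : ∀ {S} → Dec (IsEdge S) → Subset s
      trace-at (yes (_ , _ , R , _)) = R
      trace-at (no _) = ⊥
      trace : Subset (size (finite-V Q)) → Subset s
      trace S = trace-at (edge? S)
      trace-edge : ∀ {S} → (d : Dec (IsEdge S)) → T (does d) →
        ∃[ j ] Σ (Edge Q j) λ h → image (number (vert Q h)) (trace-at d) ≡ S
      trace-edge (yes (j , h , _ , _ , eq)) _ = j , h , eq
      transfer : (∃[ i ] MonoCopy shadow (c ∘ trace) i (K r (t i))) → ∃[ i ] MonoCopy (K r s) c i (K r (t i))
      transfer (i , φ , φ-inj , mono) = finish
        (copy-in-edge 2≤r (ℕₚ.≤-trans r≤t₀ (t₀≤ i)) linear (cliques (t₀≤ i)) φ φ-inj (λ S → trace (image φ S)) over)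
        where
        over : ∀ S → ∣ S ∣ ≡ r → ∃[ j ] Σ (Edge Q j) λ h → image (number (vert Q h)) (trace (image φ S)) ≡ image φ S
        over S S-r = trace-edge (edge? (image φ S)) (proj₁ (mono S (ℕₚ.≡⇒≡ᵇ ∣ S ∣ r S-r)))
        finish : (Σ (Fin (t i) → Fin s) λ θ → Injective _≡_ _≡_ θ × (∀ S → ∣ S ∣ ≡ r → image θ S ≡ trace (image φ S))) →
          ∃[ i ] MonoCopy (K r s) c i (K r (t i))
        finish (θ , θ-inj , θ-eq) = i , θ , θ-inj , mono′
          where
          size≡ : ∀ S → ∣ S ∣ ≡ r → T (∣ image θ S ∣ ≡ᵇ r)
          size≡ S S-r = ℕₚ.≡⇒≡ᵇ ∣ image θ S ∣ r (trans (∣image∣ θ-inj S) S-r)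
          colour≡ : ∀ S → T (∣ S ∣ ≡ᵇ r) → ∣ S ∣ ≡ r → c (image θ S) ≡ i
          colour≡ S S-rᵇ S-r = trans (cong c (θ-eq S S-r)) (proj₂ (mono S S-rᵇ))
          mono′ : ∀ S → T (∣ S ∣ ≡ᵇ r) → T (∣ image θ S ∣ ≡ᵇ r) × c (image θ S) ≡ i
          mono′ S S-rᵇ = size≡ S (ℕₚ.≡ᵇ⇒≡ ∣ S ∣ r S-rᵇ) , colour≡ S S-rᵇ (ℕₚ.≡ᵇ⇒≡ ∣ S ∣ r S-rᵇ)

    module _ (F : Graph r) (c : Subset (size (finite-V Q)) → Fin 2) (f : Embedding (Base.base F) Q)
             (some-edge : ∀ j → Edge (Base.base F) j) (R : Fin k → Subset s) where

      open Base F

      private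
        lift : ∀ j → Edge base j → Vec (V Q) s
        lift j h = Vec.map (fun f) (vert base {j} h)

      module _ (lift-blue : ∀ j h → ∣ R j ∣ ≡ r × c (image (number (lift j h)) (R j)) ≡ suc zero)
               (pos-surjective : ∀ (φ : Fin s → Fin n₀) → Injective _≡_ _≡_ φ → ∃[ j ] ∀ a → pos j a ≡ φ a) where

        base? : ∀ S → Dec (∃[ j ] image (pos j) (R j) ≡ S)
        base? S = any? λ j → ≡-dec Bool._≟_ (image (pos j) (R j)) S

        -- Colour an `r`-set of parts by whether some type selects it through `R`. A homogeneous set
        -- of colour `false` on `s` parts would consist of the parts of some type `j`, which selects
        -- an `r`-set inside it; hence `F` occurs among the selected sets and lifts to the copy with
        -- index `ω`.
        blue-copy : (∃[ φ ] Homogeneous {a = s} r (does ∘ base?) false φ) ⊎ (∃[ φ ] Homogeneous {a = nF} r (does ∘ base?) true φ) →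
          MonoCopy shadow c (suc zero) F
        blue-copy (inj₁ (φ , φ-inj , hom)) with pos-surjective φ φ-inj
        ... | j , pos≗φ = contradiction
          (trans (sym (hom (R j) (proj₁ (lift-blue j (some-edge j))))) (dec-true (base? _) (j , image-cong pos≗φ (R j)))) λ ()
        blue-copy (inj₂ (φ , φ-inj , hom)) = ψ , ψ-inj , ψ-blue
          where
          J-at : ∀ {S} → Dec (∃[ j ] image (pos j) (R j) ≡ S) → Maybe (Fin k)
          J-at (yes (j , _)) = just j
          J-at (no _) = nothing
          -- The copy of `F` placed on the parts given by `φ`, where each edge `S` gets a type whose
          -- selected set is `image φ S`.
          ω : Ω
          ω = tabulate φ , tabulate λ i → J-at (base? (image φ (dec (finite-Subset nF) i)))
          type-ω : ∀ S → ∣ S ∣ ≡ r → ∃[ j ] (typeOf ω S ≡ just j × image (pos j) (R j) ≡ image φ S)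
          type-ω S S-r rewrite lookup∘tabulate (λ i → J-at (base? (image φ (dec (finite-Subset nF) i)))) (enc (finite-Subset nF) S)
            | dec-enc (finite-Subset nF) S with base? (image φ S) | hom S S-r
          ... | yes (j , eq) | _ = j , refl , eq
          ψ : Fin nF → Fin (size (finite-V Q))
          ψ u = enc (finite-V Q) (fun f (inj₁ (ω , u)))
          ψ-inj : Injective _≡_ _≡_ ψ
          ψ-inj eq = cong proj₂ (inj₁-injective (injective f (enc-injective (finite-V Q) eq)))
          ψ-blue : ∀ S → T (Graph.E F S) → T (does (edge? (image ψ S))) × c (image ψ S) ≡ suc zero
          ψ-blue S ES with type-ω S (Graph.uniform F S ES)
          ... | j , type , R≡S with edges f {j} (ω , S)
          ... | h′ , eq = is-edge⁺ (j , h′ , R j , proj₁ (lift-blue j (ω , S)) , trans (cong (λ x → image (number x) (R j)) eq) same)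
                        , trans (cong c (sym same)) (proj₂ (lift-blue j (ω , S)))
            where
            core : ∀ {u a} → u ∈ S → φ u ≡ pos j a → number (lift j (ω , S)) a ≡ ψ u
            core {u} {a} u∈ eq with vertex-core⁺ {ω} {S} {j} {a} ES type u∈ (trans (lookup∘tabulate φ u) eq)
            ... | u′ , _ , eq′ , vertex≡ = cong (enc (finite-V Q)) (trans
              (lookup-map a (fun f) (vert base {j} (ω , S)))
              (cong (fun f) (trans (lookup∘tabulate (vertex ω S j) a) (trans vertex≡
                (cong (λ u → inj₁ (ω , u)) (φ-inj (trans (sym (lookup∘tabulate φ u′)) (trans eq′ (sym eq)))))))))
            -- The positions in `R j` carry exactly the vertices of `S`, so the blue `r`-set chosen
            -- in this edge is the image of `S` itself.
            same : image (number (lift j (ω , S))) (R j) ≡ image ψ S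
            same = ⊆-antisym
              (λ z∈ → let a , a∈ , eq = image-∈⁻ (number (lift j (ω , S))) (R j) z∈
                          u , u∈ , eq′ = image-∈⁻ φ S (subst (pos j a ∈_) R≡S (image-∈⁺ (pos j) a∈)) in
                subst (_∈ image ψ S) (trans (sym (core u∈ eq′)) eq) (image-∈⁺ ψ u∈))
              (λ z∈ → let u , u∈ , eq = image-∈⁻ ψ S z∈
                          a , a∈ , eq′ = image-∈⁻ (pos j) (R j) (subst (φ u ∈_) (sym R≡S) (image-∈⁺ φ u∈)) in
                subst (_∈ image (number (lift j (ω , S))) (R j)) (trans (core u∈ (sym eq′)) eq)
                  (image-∈⁺ (number (lift j (ω , S))) a∈))

    -- Without a red edge, every edge of Q has a blue r-subset. Choosing one such subset colours the
    -- edges of Q, and on some copy of the base system the choice depends on the type only.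
    shadow-arrows⁺ : (F : Graph r) → Fin s → Ramsey r s (Graph.n F) n₀ →
      (∀ (φ : Fin s → Fin n₀) → Injective _≡_ _≡_ φ → ∃[ j ] ∀ a → pos j a ≡ φ a) →
      ((χ : Vec (V Q) s → Fin (size (finite-Subset s))) →
        Σ (Embedding (Base.base F) Q) λ f → ∀ j → MonochromaticOn (Base.base F) Q χ f j) →
      Arrows shadow (pair (K r s) F)
    shadow-arrows⁺ F a₀ ram pos-surjective copy c = decide (any? λ j → exists? (finite-Edge Q j) λ h → ¬? (blue? (vert Q h)))
      where
      open Base F
      Blue : Vec (V Q) s → Set
      Blue x = ∃[ R ] (∣ R ∣ ≡ r × c (image (number x) R) ≡ suc zero)
      blue? : ∀ x → Dec (Blue x)
      blue? x = exists? (finite-Subset s) λ R → (∣ R ∣ ℕₚ.≟ r) ×-dec (c (image (number x) R) Fin.≟ suc zero)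

      decide : Dec (∃[ j ] Σ (Edge Q j) λ h → ¬ Blue (vert Q h)) → ∃[ i ] MonoCopy shadow c i (pair (K r s) F i)
      decide (yes (j , h , not-blue)) = zero , number (vert Q h) , number-injective h , red-edge
        where
        red : ∀ R → ∣ R ∣ ≡ r → c (image (number (vert Q h)) R) ≡ zero
        red R R-r with c (image (number (vert Q h)) R) in eq
        ... | zero = refl
        ... | suc zero = contradiction (R , R-r , eq) not-blue
        red-edge : ∀ R → T (∣ R ∣ ≡ᵇ r) → T (does (edge? (image (number (vert Q h)) R))) × c (image (number (vert Q h)) R) ≡ zero
        red-edge R R-rᵇ = is-edge⁺ (j , h , R , ℕₚ.≡ᵇ⇒≡ ∣ R ∣ r R-rᵇ , refl) , red R (ℕₚ.≡ᵇ⇒≡ ∣ R ∣ r R-rᵇ)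
      decide (no no-red) = suc zero , blue-copy F c f some-edge R lift-blue pos-surjective (ram λ S → does (base? F c f some-edge R lift-blue pos-surjective S))
        where
        all-blue : ∀ {j} (h : Edge Q j) → Blue (vert Q h)
        all-blue {j} h = decidable-stable (blue? (vert Q h)) λ not-blue → no-red (j , h , not-blue)
        choice-at : ∀ {x} → Dec (Blue x) → Subset s
        choice-at (yes (R , _)) = R
        choice-at (no _) = ⊥
        choice : Vec (V Q) s → Subset s
        choice x = choice-at {x} (blue? x)
        choice-blue : ∀ x → Blue x → ∣ choice x ∣ ≡ r × c (image (number x) (choice x)) ≡ suc zero
        choice-blue x blue with blue? x
        ... | yes (_ , p) = p
        ... | no not-blue = contradiction blue not-blue

        f = proj₁ (copy (enc (finite-Subset s) ∘ choice))
        lift : ∀ j → Edge base j → Vec (V Q) s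
        lift j h = Vec.map (fun f) (vert base {j} h)
        -- `R j` is read off from one edge of type `j`; any index of a copy will do, and `pos j a₀`
        -- serves as a part that certainly exists.
        some-edge : ∀ j → Edge base j
        some-edge j = (Vec.replicate _ (pos j a₀) , Vec.replicate _ nothing) , ⊥
        R : Fin k → Subset s
        R j = choice (lift j (some-edge j))
        choice≡R : ∀ j (h : Edge base j) → choice (lift j h) ≡ R j
        choice≡R j h = enc-injective (finite-Subset s)
          (proj₂ (copy (enc (finite-Subset s) ∘ choice)) j h (some-edge j))
        lift-blue : ∀ j (h : Edge base j) → ∣ R j ∣ ≡ r × c (image (number (lift j h)) (R j)) ≡ suc zero
        lift-blue j h = subst (λ R → ∣ R ∣ ≡ r × c (image (number (lift j h)) R) ≡ suc zero) (choice≡R j h)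
          (choice-blue (lift j h) (let h′ , eq = edges f {j} h in subst Blue eq (all-blue h′)))

-- The types, as a list of all injections of positions into parts.

injections : ∀ s n → ∃[ k ] Σ (Fin k → Fin s → Fin n) λ pos → (∀ j → Injective _≡_ _≡_ (pos j)) ×
  (∀ (φ : Fin s → Fin n) → Injective _≡_ _≡_ φ → ∃[ j ] ∀ a → pos j a ≡ φ a)
injections s n = List.length injs , (λ j → lookup (List.lookup injs j)) ,
  (λ j → proj₂ (∈-filter⁻ inj? {xs = words} (∈-lookup j)) _ _) , surjective
  where
  finite = finite-Vec (finite-Fin n) s
  words : List (Vec (Fin n) s)
  words = List.map (dec finite) (allFin (size finite))
  Inj : Vec (Fin n) s → Set
  Inj w = ∀ a b → lookup w a ≡ lookup w b → a ≡ b
  inj? : ∀ w → Dec (Inj w)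
  inj? w = all? λ a → all? λ b → (lookup w a Fin.≟ lookup w b) →-dec (a Fin.≟ b)
  injs = List.filter inj? words
  surjective : ∀ (φ : Fin s → Fin n) → Injective _≡_ _≡_ φ → ∃[ j ] ∀ a → lookup (List.lookup injs j) a ≡ φ a
  surjective φ φ-inj = Any.index w∈ , λ a → trans (cong (λ w → lookup w a) (sym (lookup-index w∈))) (lookup∘tabulate φ a)
    where
    w∈ : tabulate φ ∈ˡ injs
    w∈ = ∈-filter⁺ inj?
      (subst (_∈ˡ words) (dec-enc finite (tabulate φ)) (∈-map⁺ (dec finite) (∈-allFin (enc finite (tabulate φ)))))
      (λ a b eq → φ-inj (trans (sym (lookup∘tabulate φ a)) (trans eq (lookup∘tabulate φ b))))

-- Density is monotone under embeddings

lookup-injective : ∀ {A : Set} {xs : List A} → Unique xs → Injective _≡_ _≡_ (List.lookup xs)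
lookup-injective (_ ∷ _) {zero} {zero} _ = refl
lookup-injective (x∉ ∷ _) {zero} {suc j} eq = contradiction eq (All.lookup x∉ (∈-lookup j))
lookup-injective (x∉ ∷ _) {suc i} {zero} eq = contradiction (sym eq) (All.lookup x∉ (∈-lookup i))
lookup-injective (_ ∷ u) {suc i} {suc j} eq = cong suc (lookup-injective u eq)

length-≤ : ∀ {A B : Set} {xs : List A} {ys : List B} {f : A → B} → Unique xs → Injective _≡_ _≡_ f →
  (∀ {x} → x ∈ˡ xs → f x ∈ˡ ys) → List.length xs ≤ List.length ys
length-≤ {xs = xs} {ys} {f} uniq f-inj f∈ = injective⇒≤ {f = λ i → Any.index (f∈ (∈-lookup i))} inj
  where
  inj : Injective _≡_ _≡_ (λ i → Any.index (f∈ (∈-lookup {xs = xs} i)))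
  inj {i} {j} eq = lookup-injective uniq (f-inj (trans (lookup-index (f∈ (∈-lookup i)))
    (trans (cong (List.lookup ys) eq) (sym (lookup-index (f∈ (∈-lookup j)))))))

∈-subsets : ∀ {n} (S : Subset n) → S ∈ˡ subsets n
∈-subsets [] = here refl
∈-subsets (false ∷ S) = ∈-++⁺ˡ (∈-map⁺ (false ∷_) (∈-subsets S))
∈-subsets (true ∷ S) = ∈-++⁺ʳ _ (∈-map⁺ (true ∷_) (∈-subsets S))

subsets-unique : ∀ n → Unique (subsets n)
subsets-unique zero = [] ∷ []
subsets-unique (suc n) = Uniqueₚ.++⁺ (Uniqueₚ.map⁺ ∷-injectiveʳ (subsets-unique n))
  (Uniqueₚ.map⁺ ∷-injectiveʳ (subsets-unique n)) disjoint
  where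
  disjoint : ∀ {S} → ¬ (S ∈ˡ List.map (false ∷_) (subsets n) × S ∈ˡ List.map (true ∷_) (subsets n))
  disjoint (S∈ , S∈′) with ∈-map⁻ (false ∷_) S∈ | ∈-map⁻ (true ∷_) S∈′
  ... | _ , _ , refl | _ , _ , ()

module _ {A : Set} where

  ∈-sublist : ∀ {xs L : List A} → L ∈ˡ sublists xs → ∀ {x} → x ∈ˡ L → x ∈ˡ xs
  ∈-sublist {[]} (here refl) ()
  ∈-sublist {y ∷ xs} L∈ x∈ with ∈-++⁻ (sublists xs) L∈
  ... | inj₁ L∈′ = there (∈-sublist L∈′ x∈)
  ... | inj₂ L∈′ with ∈-map⁻ (y ∷_) L∈′ | x∈
  ... | _ , _ , refl | here eq = here eq
  ... | _ , M∈ , refl | there x∈′ = there (∈-sublist M∈ x∈′)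

  sublist-unique : ∀ {xs L : List A} → L ∈ˡ sublists xs → Unique xs → Unique L
  sublist-unique {[]} (here refl) _ = []
  sublist-unique {y ∷ xs} L∈ (y∉ ∷ uniq) with ∈-++⁻ (sublists xs) L∈
  ... | inj₁ L∈′ = sublist-unique L∈′ uniq
  ... | inj₂ L∈′ with ∈-map⁻ (y ∷_) L∈′
  ... | _ , M∈ , refl = All.tabulate (λ x∈ → All.lookup y∉ (∈-sublist M∈ x∈)) ∷ sublist-unique M∈ uniq

  filterᵇ-sublist : ∀ p (xs : List A) → List.filterᵇ p xs ∈ˡ sublists xs
  filterᵇ-sublist p [] = here refl
  filterᵇ-sublist p (x ∷ xs) with p x
  ... | false = ∈-++⁺ˡ (filterᵇ-sublist p xs)
  ... | true = ∈-++⁺ʳ _ (∈-map⁺ (x ∷_) (filterᵇ-sublist p xs))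

∈-filterᵇ⁺ : ∀ {A : Set} (p : A → Bool) {xs x} → x ∈ˡ xs → T (p x) → x ∈ˡ List.filterᵇ p xs
∈-filterᵇ⁺ p = ∈-filter⁺ (T? ∘ p)

∈-filterᵇ⁻ : ∀ {A : Set} (p : A → Bool) {xs x} → x ∈ˡ List.filterᵇ p xs → x ∈ˡ xs × T (p x)
∈-filterᵇ⁻ p = ∈-filter⁻ (T? ∘ p)

⊆ᵇ⇒⊆ : ∀ {n} (S U : Subset n) → T (S ⊆ᵇ U) → S ⊆ U
⊆ᵇ⇒⊆ (false ∷ S) (_ ∷ U) sub (there x∈) = there (⊆ᵇ⇒⊆ S U sub x∈)
⊆ᵇ⇒⊆ (true ∷ S) (true ∷ U) sub here = here
⊆ᵇ⇒⊆ (true ∷ S) (true ∷ U) sub (there x∈) = there (⊆ᵇ⇒⊆ S U sub x∈)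

⊆⇒⊆ᵇ : ∀ {n} (S U : Subset n) → S ⊆ U → T (S ⊆ᵇ U)
⊆⇒⊆ᵇ [] [] _ = _
⊆⇒⊆ᵇ (false ∷ S) (_ ∷ U) sub = ⊆⇒⊆ᵇ S U (drop-∷-⊆ sub)
⊆⇒⊆ᵇ (true ∷ S) (true ∷ U) sub = ⊆⇒⊆ᵇ S U (drop-∷-⊆ sub)
⊆⇒⊆ᵇ (true ∷ S) (false ∷ U) sub = case sub here of λ ()

/-monoˡ-≤ : ∀ d {a b} → a ≤ b → ((ℤ.+ a ℤ.- ℤ.+ 1) ℚ./ suc d) ℚ.≤ ((ℤ.+ b ℤ.- ℤ.+ 1) ℚ./ suc d)
/-monoˡ-≤ d {a} {b} a≤b = ℚₚ.toℚᵘ-cancel-≤ (begin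
  ℚ.toℚᵘ (ℚ.fromℚᵘ (ℚᵘ.mkℚᵘ (ℤ.+ a ℤ.- ℤ.+ 1) d))   ≃⟨ ℚₚ.toℚᵘ-fromℚᵘ (ℚᵘ.mkℚᵘ (ℤ.+ a ℤ.- ℤ.+ 1) d) ⟩
  ℚᵘ.mkℚᵘ (ℤ.+ a ℤ.- ℤ.+ 1) d                        ≤⟨ ℚᵘ.*≤* (ℤₚ.*-monoʳ-≤-nonNeg (ℤ.+ suc d) (ℤₚ.+-monoˡ-≤ (ℤ.- ℤ.+ 1) (ℤ.+≤+ a≤b))) ⟩
  ℚᵘ.mkℚᵘ (ℤ.+ b ℤ.- ℤ.+ 1) d                        ≃⟨ ℚₚ.toℚᵘ-fromℚᵘ (ℚᵘ.mkℚᵘ (ℤ.+ b ℤ.- ℤ.+ 1) d) ⟨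
  ℚ.toℚᵘ (ℚ.fromℚᵘ (ℚᵘ.mkℚᵘ (ℤ.+ b ℤ.- ℤ.+ 1) d))   ∎)
  where open ℚᵘₚ.≤-Reasoning

ratio-mono-≤ : ∀ r u {a b} → a ≤ b → ratio r u a ℚ.≤ ratio r u b
ratio-mono-≤ r u a≤b with r ℕ.<ᵇ u
... | false = ℚₚ.≤-refl
... | true with u ∸ r
... | zero = ℚₚ.≤-refl
... | suc d = /-monoˡ-≤ d a≤b

maximum : List ℚ → ℚ
maximum = List.foldr ℚ._⊔_ 0ℚ

0≤maximum : ∀ xs → 0ℚ ℚ.≤ maximum xs
0≤maximum [] = ℚₚ.≤-refl
0≤maximum (x ∷ xs) = ℚₚ.≤-trans (0≤maximum xs) (ℚₚ.p≤q⊔p x (maximum xs))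

≤-maximum : ∀ {xs x} → x ∈ˡ xs → x ℚ.≤ maximum xs
≤-maximum {x ∷ xs} (here refl) = ℚₚ.p≤p⊔q x (maximum xs)
≤-maximum {y ∷ xs} (there x∈) = ℚₚ.≤-trans (≤-maximum x∈) (ℚₚ.p≤q⊔p y (maximum xs))

maximum-≤ : ∀ {xs b} → 0ℚ ℚ.≤ b → (∀ {x} → x ∈ˡ xs → x ℚ.≤ b) → maximum xs ℚ.≤ b
maximum-≤ {[]} 0≤b _ = 0≤b
maximum-≤ {x ∷ xs} 0≤b ≤b = ℚₚ.⊔-lub (≤b (here refl)) (maximum-≤ 0≤b (≤b ∘ there))

SubgraphDensity : ∀ {r} (F : Graph r) → ℚ → Set
SubgraphDensity {r} F d = Σ (Subset (Graph.n F)) λ U → T (r ℕ.<ᵇ ∣ U ∣) × Σ (List (Subset (Graph.n F))) λ L →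
  L ∈ˡ sublists (edgeList F) × (∀ {S} → S ∈ˡ L → S ⊆ U) × d ≡ ratio r ∣ U ∣ (List.length L)

∈-densities⁻ : ∀ {r} (F : Graph r) {d} → d ∈ˡ densities F → SubgraphDensity F d
∈-densities⁻ {r} F d∈ with find (∈-concatMap⁻ _ {xs = subsets (Graph.n F)} d∈)
... | U , _ , d∈U with r ℕ.<ᵇ ∣ U ∣ in r<U
... | true with ∈-map⁻ _ d∈U
... | L , L∈ , d≡ with ∈-filterᵇ⁻ (all (_⊆ᵇ U)) {xs = sublists (edgeList F)} L∈
... | L∈′ , L⊆U = U , Equivalence.from T-≡ r<U , L , L∈′ , (λ S∈ → ⊆ᵇ⇒⊆ _ U (All.lookup (all⁺ (_⊆ᵇ U) L L⊆U) S∈)) , d≡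

-- The summand of densities is local to its definition; unification recovers it.
densities-summand : ∀ {r} (F : Graph r) → Σ (Subset (Graph.n F) → List ℚ) λ f →
  densities F ≡ List.concatMap f (subsets (Graph.n F))
densities-summand F = _ , refl

∈-densities⁺ : ∀ {r} (F : Graph r) {d} → SubgraphDensity F d → d ∈ˡ densities F
∈-densities⁺ {r} F (U , r<U , L , L∈ , L⊆U , refl) =
  ∈-concatMap⁺ (proj₁ (densities-summand F)) (lose (∈-subsets U) (at-U r<U L∈U))
  where
  L∈U : L ∈ˡ List.filterᵇ (all (_⊆ᵇ U)) (sublists (edgeList F))
  L∈U = ∈-filterᵇ⁺ (all (_⊆ᵇ U)) L∈ (all⁻ (_⊆ᵇ U) (All.tabulate (λ S∈ → ⊆⇒⊆ᵇ _ U (L⊆U S∈))))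
  at-U : T (r ℕ.<ᵇ ∣ U ∣) → L ∈ˡ List.filterᵇ (all (_⊆ᵇ U)) (sublists (edgeList F)) →
    ratio r ∣ U ∣ (List.length L) ∈ˡ proj₁ (densities-summand F) U
  at-U r<U L∈ with r ℕ.<ᵇ ∣ U ∣ in eq
  ... | true rewrite eq = ∈-map⁺ _ L∈

m-≡-maximum : ∀ {r} (F : Graph r) → 2 ≤ e F → m r F ≡ maximum (densities F)
m-≡-maximum F 2≤e with e F | 2≤e
... | suc (suc _) | _ = refl
... | suc zero | s≤s ()

subset-of-size : ∀ {n} r → r ≤ n → Σ (Subset n) λ S → ∣ S ∣ ≡ r
subset-of-size {n} r r≤n = image (λ x → Fin.inject≤ x r≤n) ⊤ ,
  ⊤-∣image∣ (λ {x} {y} → inject≤-injective r≤n r≤n x y)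

2≤length : ∀ {A : Set} {xs : List A} {x y} → x ∈ˡ xs → y ∈ˡ xs → x ≢ y → 2 ≤ List.length xs
2≤length (here refl) (here refl) x≢y = contradiction refl x≢y
2≤length {xs = _ ∷ _ ∷ _} _ _ _ = s≤s (s≤s z≤n)
2≤length {xs = _ ∷ []} (here _) (there ())
2≤length {xs = _ ∷ []} (there ()) _

-- Puts `K r t`, and any `F` containing it, into the case of `m` with at least two edges. One edge
-- contains the vertex `zero`, the other avoids it.
two-edges : ∀ {r t} → 2 ≤ r → r < t →
  ∃[ S ] ∃[ S′ ] (S ∈ˡ edgeList (K r t) × S′ ∈ˡ edgeList (K r t) × S ≢ S′)
two-edges {suc r} {suc t} _ (s≤s r<t) =
  let S , S-r = subset-of-size {t} r (ℕₚ.<⇒≤ r<t)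
      S′ , S′-r = subset-of-size {t} (suc r) r<t
  in true ∷ S , false ∷ S′
   , ∈-filterᵇ⁺ (Graph.E (K (suc r) (suc t))) (∈-subsets (true ∷ S)) (ℕₚ.≡⇒≡ᵇ (suc ∣ S ∣) (suc r) (cong suc S-r))
   , ∈-filterᵇ⁺ (Graph.E (K (suc r) (suc t))) (∈-subsets (false ∷ S′)) (ℕₚ.≡⇒≡ᵇ ∣ S′ ∣ (suc r) S′-r)
   , λ ()

module _ {r t : ℕ} (2≤r : 2 ≤ r) (r<t : r < t) (F : Graph r) (φ : Fin t → Fin (Graph.n F))
         (φ-inj : Injective _≡_ _≡_ φ) (clique : ∀ S → ∣ S ∣ ≡ r → T (Graph.E F (image φ S))) where

  image-edge : ∀ {S} → S ∈ˡ edgeList (K r t) → image φ S ∈ˡ edgeList F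
  image-edge {S} S∈ = ∈-filterᵇ⁺ (Graph.E F) (∈-subsets _)
    (clique S (ℕₚ.≡ᵇ⇒≡ ∣ S ∣ r (proj₂ (∈-filterᵇ⁻ (Graph.E (K r t)) {xs = subsets t} S∈))))

  -- A subgraph on `U` is compared with the one on `image φ U` having all edges of `F` there:
  -- equally many vertices and at least as many edges.
  clique-density : m r (K r t) ℚ.≤ m r F
  clique-density =
    let S , S′ , S∈ , S′∈ , S≢S′ = two-edges 2≤r r<t
    in subst₂ ℚ._≤_ (sym (m-≡-maximum (K r t) (2≤length S∈ S′∈ S≢S′)))
      (sym (m-≡-maximum F (2≤length (image-edge S∈) (image-edge S′∈) (S≢S′ ∘ image-injective φ-inj))))
      (maximum-≤ (0≤maximum (densities F)) dominated)
    where
    dominated : ∀ {d} → d ∈ˡ densities (K r t) → d ℚ.≤ maximum (densities F)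
    dominated d∈ with ∈-densities⁻ (K r t) d∈
    ... | U , r<U , L , L∈ , L⊆U , refl = ℚₚ.≤-trans
      (subst (λ u → ratio r ∣ U ∣ (List.length L) ℚ.≤ ratio r u (List.length L′)) (sym (∣image∣ φ-inj U)) (ratio-mono-≤ r ∣ U ∣ L≤L′))
      (≤-maximum (∈-densities⁺ F (image φ U , subst (λ u → T (r ℕ.<ᵇ u)) (sym (∣image∣ φ-inj U)) r<U
        , L′ , filterᵇ-sublist (_⊆ᵇ image φ U) (edgeList F)
        , (λ S∈ → ⊆ᵇ⇒⊆ _ _ (proj₂ (∈-filterᵇ⁻ (_⊆ᵇ image φ U) {xs = edgeList F} S∈))) , refl)))
      where
      L′ = List.filterᵇ (_⊆ᵇ image φ U) (edgeList F)
      image-mono : ∀ {S} → S ⊆ U → image φ S ⊆ image φ U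
      image-mono {S} S⊆U z∈ = let x , x∈ , eq = image-∈⁻ φ S z∈ in subst (_∈ image φ U) eq (image-∈⁺ φ (S⊆U x∈))
      L≤L′ : List.length L ≤ List.length L′
      L≤L′ = length-≤ (sublist-unique L∈ (Uniqueₚ.filter⁺ (T? ∘ Graph.E (K r t)) (subsets-unique t))) (image-injective φ-inj)
        λ {S} S∈ → ∈-filterᵇ⁺ (_⊆ᵇ image φ U) (image-edge (∈-sublist L∈ S∈)) (⊆⇒⊆ᵇ _ _ (image-mono (L⊆U S∈)))

clique-free : ∀ {r t t′} → 2 ≤ r → r < t → t ≤ t′ → (F : Graph r) → m r F <ℚ m r (K r t) →
  (u : Fin t′ → Fin (Graph.n F)) → Injective _≡_ _≡_ u →
  ¬ ((ρ : Fin r → Fin t′) → Injective _≡_ _≡_ ρ → T (Graph.E F (image (u ∘ ρ) ⊤)))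
clique-free {r} {t} {t′} 2≤r r<t t≤t′ F sparse u u-inj clique =
  ℚₚ.<-irrefl refl (ℚₚ.<-≤-trans sparse (clique-density 2≤r r<t F (u ∘ ι) (λ eq → ι-inj (u-inj eq)) edge))
  where
  ι : Fin t → Fin t′
  ι x = Fin.inject≤ x t≤t′
  ι-inj : Injective _≡_ _≡_ ι
  ι-inj {x} {y} = inject≤-injective t≤t′ t≤t′ x y
  edge : ∀ S → ∣ S ∣ ≡ r → T (Graph.E F (image (u ∘ ι) S))
  edge S S-r = let ρ , enum@(ρ-inj , _) = enumeration r S S-r in
    subst (T ∘ Graph.E F) (trans (image-∘ (u ∘ ι) ρ ⊤) (cong (image (u ∘ ι)) (image-⊤ ρ S enum)))
      (clique (ι ∘ ρ) (λ eq → ρ-inj (ι-inj eq)))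

-- Choice of the parameters and conclusion.

theorem1p2 : (r k : ℕ) → 2 ≤ r → 1 ≤ k
    → (t : Fin (suc k) → ℕ)
    → (∀ i j → i Data.Fin.≤ j → t j ≤ t i)
    → r < t (fromℕ k)
    → (F : Graph r)
    → m r F <ℚ m r (K r (t (fromℕ k)))
    → (N : ℕ) → IsRamseyNumber (λ i → K r (t i)) N
    → ∃[ G ] (¬ Arrows G (λ i → K r (t i))
    × Arrows G (pair (K r (N ∸ 1)) F))
theorem1p2 r k 2≤r _ t t-mono r<t F sparse N ((G₀ , G₀≡N , G₀-arrows) , N-minimal)
  with ramsey r (N ∸ 1) (Graph.n F)
... | n₀ , ram with injections (N ∸ 1) n₀
... | types , pos , pos-inj , pos-sur = Shadow.shadow Q , not-arrows , arrows
  where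
  open Partite pos pos-inj r
  t₀ = t (fromℕ k)
  t₀≤ : ∀ i → t₀ ≤ t i
  t₀≤ i = t-mono i (fromℕ k) (≤fromℕ i)
  -- A constant colouring of `G₀` shows that `N` is at least one of the `t i`, hence above `r`. So
  -- `N ∸ 1` is a true predecessor and `Fin (N ∸ 1)` is inhabited.
  r<N : r < N
  r<N = let i , φ , φ-inj , _ = G₀-arrows (λ _ → zero) in
    subst (r <_) G₀≡N (ℕₚ.<-≤-trans r<t (ℕₚ.≤-trans (t₀≤ i) (injective⇒≤ φ-inj)))
  N∸1<N : N ∸ 1 < N
  N∸1<N = ℕₚ.∸-monoʳ-< {N} {1} {0} (s≤s z≤n) (ℕₚ.≤-trans (s≤s z≤n) r<N)
  a₀ : Fin (N ∸ 1)
  a₀ = Fin.fromℕ< (ℕₚ.≤-trans (ℕₚ.≤-trans (s≤s z≤n) 2≤r) (ℕₚ.∸-monoˡ-≤ 1 r<N))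
  -- The colours are the subsets of the `N ∸ 1` positions: an edge will be coloured by the
  -- `r`-subset chosen from it.
  construction = partite-construction (size (finite-Subset (N ∸ 1))) 2≤r (ℕₚ.<⇒≤ r<t) (allFin types) (Base.base F)
    record { linear = Base.base-linear F 2≤r
           ; cliques = λ t₀≤t′ → Base.base-cliques F 2≤r (ℕₚ.≤-trans (ℕₚ.<⇒≤ r<t) t₀≤t′)
               (clique-free 2≤r r<t t₀≤t′ F sparse) }
  Q = proj₁ construction
  not-arrows : ¬ Arrows (Shadow.shadow Q) (λ i → K r (t i))
  -- Otherwise the complete `r`-graph on `N ∸ 1` vertices would arrow as well, against the
  -- minimality of `N`.
  not-arrows G-arrows = ℕₚ.<⇒≱ N∸1<N (N-minimal (K r (N ∸ 1))
    (Shadow.shadow-arrows⁻ Q 2≤r (ℕₚ.<⇒≤ r<t) (proj₁ (proj₂ construction)) t t₀≤ G-arrows))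
  arrows : Arrows (Shadow.shadow Q) (pair (K r (N ∸ 1)) F)
  arrows = Shadow.shadow-arrows⁺ Q F a₀ ram pos-sur
    λ χ → let f , mono = proj₂ (proj₂ construction) χ in f , λ j → mono (∈-allFin j)
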